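{- Every finitely satisfiable two-variable $\mathrm{UNFO}{+}\mathcal{S}$ formula $\phi$ has a finite (admissible) model of size bounded triply exponentially in $|\phi|$, i.e. of size at most $2^{2^{2^{p(|\phi|)}}}$ for some fixed polynomial $p$.
   Context: Signatures are purely relational, $\sigma=\sigma_{\mathrm{base}}\cup\sigma_{\mathrm{dist}}$ with $\sigma_{\mathrm{dist}}=\{T_1,\dots,T_{2k}\}$ binary. $\mathrm{UNFO}$ formulas are given by $\phi ::= B\bar x \mid x=y \mid \phi\wedge\phi \mid \phi\vee\phi \mid \exists x\,\phi \mid \neg\phi(x)$, where in the last clause $\phi$ has at most the free variable $x$. $\mathrm{UNFO}{+}\mathcal{S}$ has the same syntax, but admissible structures must interpret each $T_u$ as a transitive relation and $T_{2u}$ as the inverse of $T_{2u-1}$ ($1\le u\le k$). A two-variable formula uses only the variables $x,y$; in the two-variable setting formulas use only relation symbols of arity at most $2$. $|\phi|$ is the length of $\phi$. -}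

module Defs where

open import Data.Nat using (ℕ; zero; suc; _+_; _*_; _^_; _≤_)
open import Data.Fin using (Fin)
open import Data.Bool using (Bool; true; false; _∧_; _∨_; not)
open import Data.List using (List; []; _∷_)
open import Data.Product using (Σ; _×_; _,_; ∃-syntax)
open import Data.Sum using (_⊎_)
open import Data.Unit using (⊤)
open import Relation.Nullary using (¬_)
open import Relation.Binary.PropositionalEquality using (_≡_)

data Var : Set where
  vx vy : Var

-- Distinguished symbols: for u : Fin k (standing for 1 ≤ u+1 ≤ k),
--   (u , fwd) is T_{2(u+1)-1}   and   (u , bwd) is T_{2(u+1)}.
data Dir : Set where
  fwd bwd : Dir

TSym : ℕ → Set
TSym k = Fin k × Dir

-- Formulas over σ = σ_base ∪ {T_1,…,T_2k}; σ_base has an unlimited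
-- supply of nullary, unary and binary symbols (indexed by ℕ), since in
-- the two-variable setting relation symbols have arity at most 2.
data Fm (k : ℕ) : Set where
  B0   : ℕ → Fm k
  B1   : ℕ → Var → Fm k
  B2   : ℕ → Var → Var → Fm k
  TA   : TSym k → Var → Var → Fm k
  eq   : Var → Var → Fm k
  _∧ᶠ_ : Fm k → Fm k → Fm k
  _∨ᶠ_ : Fm k → Fm k → Fm k
  ex   : Var → Fm k → Fm k
  neg  : Fm k → Fm k

_≟ᵛ_ : Var → Var → Bool
vx ≟ᵛ vx = true
vy ≟ᵛ vy = true
_  ≟ᵛ _  = false

free : ∀ {k} → Fm k → Var → Bool
free (B0 _)     z = false
free (B1 _ a)   z = a ≟ᵛ z
free (B2 _ a b) z = (a ≟ᵛ z) ∨ (b ≟ᵛ z)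
free (TA _ a b) z = (a ≟ᵛ z) ∨ (b ≟ᵛ z)
free (eq a b)   z = (a ≟ᵛ z) ∨ (b ≟ᵛ z)
free (φ ∧ᶠ ψ)   z = free φ z ∨ free ψ z
free (φ ∨ᶠ ψ)   z = free φ z ∨ free ψ z
free (ex a φ)   z = not (a ≟ᵛ z) ∧ free φ z
free (neg φ)    z = free φ z

IsUNFO : ∀ {k} → Fm k → Set
IsUNFO (φ ∧ᶠ ψ) = IsUNFO φ × IsUNFO ψ
IsUNFO (φ ∨ᶠ ψ) = IsUNFO φ × IsUNFO ψ
IsUNFO (ex _ φ) = IsUNFO φ
IsUNFO (neg φ)  = (free φ vx ∧ free φ vy ≡ false) × IsUNFO φ
IsUNFO _        = ⊤

-- length |φ| (number of symbol occurrences)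
len : ∀ {k} → Fm k → ℕ
len (B0 _)     = 1
len (B1 _ _)   = 2
len (B2 _ _ _) = 3
len (TA _ _ _) = 3
len (eq _ _)   = 3
len (φ ∧ᶠ ψ)   = suc (len φ + len ψ)
len (φ ∨ᶠ ψ)   = suc (len φ + len ψ)
len (ex _ φ)   = 2 + len φ
len (neg φ)    = suc (len φ)

record Str (k n : ℕ) : Set where
  field
    R0 : ℕ → Bool
    R1 : ℕ → Fin n → Bool
    R2 : ℕ → Fin n → Fin n → Bool
    RT : TSym k → Fin n → Fin n → Bool
open Str public

Admissible : ∀ {k n} → Str k n → Set
Admissible {k} {n} S =
  (∀ (i : TSym k) (a b c : Fin n) →
     RT S i a b ≡ true → RT S i b c ≡ true → RT S i a c ≡ true)
  × (∀ (u : Fin k) (a b : Fin n) → RT S (u , bwd) a b ≡ RT S (u , fwd) b a)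

Asg : ℕ → Set
Asg n = Var → Fin n

update : ∀ {n} → Asg n → Var → Fin n → Asg n
update ρ z d w with z ≟ᵛ w
... | true  = d
... | false = ρ w

_⊨_[_] : ∀ {k n} → Str k n → Fm k → Asg n → Set
S ⊨ B0 r     [ ρ ] = R0 S r ≡ true
S ⊨ B1 r a   [ ρ ] = R1 S r (ρ a) ≡ true
S ⊨ B2 r a b [ ρ ] = R2 S r (ρ a) (ρ b) ≡ true
S ⊨ TA i a b [ ρ ] = RT S i (ρ a) (ρ b) ≡ true
S ⊨ eq a b   [ ρ ] = ρ a ≡ ρ b
S ⊨ φ ∧ᶠ ψ   [ ρ ] = (S ⊨ φ [ ρ ]) × (S ⊨ ψ [ ρ ])
S ⊨ φ ∨ᶠ ψ   [ ρ ] = (S ⊨ φ [ ρ ]) ⊎ (S ⊨ ψ [ ρ ])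
S ⊨ ex z φ   [ ρ ] = Σ _ λ d → S ⊨ φ [ update ρ z d ]
S ⊨ neg φ    [ ρ ] = ¬ (S ⊨ φ [ ρ ])

HasAdmModelOfSize : ∀ {k} → Fm k → ℕ → Set
HasAdmModelOfSize {k} φ n =
  Σ (Str k n) λ S → Admissible S × Σ (Asg n) λ ρ → S ⊨ φ [ ρ ]

FinSat : ∀ {k} → Fm k → Set
FinSat φ = ∃[ n ] HasAdmModelOfSize φ n

Poly : Set
Poly = List ℕ

evalP : Poly → ℕ → ℕ
evalP []       x = 0
evalP (c ∷ cs) x = c + x * evalP cs x

{-# OPTIONS --safe #-}

-- Fix a finite model A; the type of an element is the set of subformulas true
-- of it. As only two variables occur, a structure B satisfies the formula as
-- soon as every pair of B maps to a pair of A with the same types, preserving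
-- atoms, and every element of B has copies of the witnesses of some element of
-- A with its type.
--
-- Let code a consist of the type of a and, for every set S of (possibly
-- inverted) transitive symbols, of the types found S-above a; there are doubly
-- exponentially many codes. First A is folded into a graph whose vertices are
-- codes with a bounded memory and whose edges are the demands for witnesses, so
-- that every transitive relation admits a rank, strictly increasing along its
-- one-way edges and constant along its two-way edges. The condition to be met
-- along a branch is of Streett type (if infinitely many edges are one-way for
-- T, then infinitely many are not in T), so the memory is an index appearance
-- record: the symbols are listed in order of priority, those missing from the
-- current edge move to the end, and each vertex is represented by an element
-- of A whose strict upper sets are lexicographically smallest in this order.
--
-- Then the graph is unfolded into B = vertices × (ℤ/m)^edges, where walking
-- along an edge adds 1 to its coordinate. If c is reached from b by a walk
-- inside each relation of a set S, all these walks induce the same flow modulo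
-- m, hence a flow through edges common to S; a cut argument turns it into
-- reachability inside S in the graph, so the pair (b , c) has an image in A.

module Submission where

open import Defs
open import Data.Nat as ℕ using (ℕ; zero; suc; _+_; _*_; _^_; _≤_; _<_; _⊔_; _∸_; z≤n; s≤s; NonZero)
import Data.Nat.Properties as N
import Data.Nat.Divisibility as ND
open import Data.Nat.DivMod using (_%_; _/_; m%n<n; m≡m%n+[m/n]*n)
open import Data.Nat.Tactic.RingSolver renaming (solve-∀ to solve-ℕ)
open import Data.Integer as ℤ using (ℤ; +_; 0ℤ; 1ℤ)
import Data.Integer.Properties as Z
open import Data.Integer.Divisibility.Signed using (_∣_; divides; _∣?_; ∣⇒∣ᵤ; ∣m∣n⇒∣m+n; ∣m⇒∣-m; ∣m⇒∣m*n)
open import Data.Integer.Tactic.RingSolver using (solve-∀)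
open import Data.Fin using (Fin; zero; suc; toℕ; fromℕ<; combine; remQuot; finToFun; funToFin; splitAt; _↑ˡ_; _↑ʳ_)
import Data.Fin.Properties as F
import Data.Fin.Subset as Sub
import Data.Fin.Subset.Properties as SubP
open import Data.Bool using (Bool; true; false; _∧_; _∨_; not)
import Data.Bool.Properties as Bo
open import Data.List using (List; []; _∷_; _++_; length; lookup)
open import Data.List.Properties using (length-++)
open import Data.List.Relation.Unary.Any using (here; there; index)
open import Data.List.Relation.Unary.Any.Properties using (lookup-index)
open import Data.List.Membership.Propositional using (_∈_)
open import Data.List.Membership.Propositional.Properties using (∈-++⁺ˡ; ∈-++⁺ʳ; ∈-++⁻)
open import Data.Vec as V using (Vec; []; _∷_; _∷ʳ_; tabulate; allFin)
import Data.Vec.Properties as VP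
open import Data.Product using (Σ; ∃; ∃-syntax; _×_; _,_; proj₁; proj₂)
open import Data.Sum using (_⊎_; inj₁; inj₂; [_,_]′)
open import Data.Unit using (⊤; tt)
open import Data.Empty using (⊥; ⊥-elim)
open import Function using (_∘_; const)
open import Relation.Nullary using (¬_; Dec; yes; no; does)
open import Relation.Nullary.Decidable using (_×-dec_; _⊎-dec_; _→-dec_; ¬?)
open import Relation.Binary using (tri<; tri≈; tri>)
open import Relation.Binary.PropositionalEquality
open import Algebra.Properties.Monoid.Sum Z.+-0-monoid using (sum)

-- Semantics: decidability and free variables.

true≢false : true ≢ false
true≢false ()

∨-trueˡ : ∀ {a b} → a ≡ true → a ∨ b ≡ true
∨-trueˡ refl = refl

∨-trueʳ : ∀ a {b} → b ≡ true → a ∨ b ≡ true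
∨-trueʳ true  _ = refl
∨-trueʳ false p = p

≟ᵛ-refl : ∀ z → (z ≟ᵛ z) ≡ true
≟ᵛ-refl vx = refl
≟ᵛ-refl vy = refl

module _ {k n : ℕ} (S : Str k n) where

  sat? : ∀ ψ (ρ : Asg n) → Dec (S ⊨ ψ [ ρ ])
  sat? (B0 r)     ρ = R0 S r Bo.≟ true
  sat? (B1 r a)   ρ = R1 S r (ρ a) Bo.≟ true
  sat? (B2 r a b) ρ = R2 S r (ρ a) (ρ b) Bo.≟ true
  sat? (TA i a b) ρ = RT S i (ρ a) (ρ b) Bo.≟ true
  sat? (eq a b)   ρ = ρ a F.≟ ρ b
  sat? (φ ∧ᶠ ψ)   ρ = sat? φ ρ ×-dec sat? ψ ρ
  sat? (φ ∨ᶠ ψ)   ρ = sat? φ ρ ⊎-dec sat? ψ ρ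
  sat? (ex z φ)   ρ = F.any? (λ d → sat? φ (update ρ z d))
  sat? (neg φ)    ρ = ¬? (sat? φ ρ)

  update-agree : ∀ {ρ ρ′ : Asg n} a d (ψ : Fm k) →
    (∀ z → free (ex a ψ) z ≡ true → ρ z ≡ ρ′ z) →
    ∀ z → free ψ z ≡ true → update ρ a d z ≡ update ρ′ a d z
  update-agree vx d ψ H vx p = refl
  update-agree vx d ψ H vy p = H vy p
  update-agree vy d ψ H vx p = H vx p
  update-agree vy d ψ H vy p = refl

  sat-agree : ∀ ψ {ρ ρ′ : Asg n} → (∀ z → free ψ z ≡ true → ρ z ≡ ρ′ z) →
    S ⊨ ψ [ ρ ] → S ⊨ ψ [ ρ′ ]
  sat-agree (B0 r)     H p = p
  sat-agree (B1 r a)   H p rewrite H a (≟ᵛ-refl a) = p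
  sat-agree (B2 r a b) H p
    rewrite H a (∨-trueˡ (≟ᵛ-refl a)) | H b (∨-trueʳ (a ≟ᵛ b) (≟ᵛ-refl b)) = p
  sat-agree (TA i a b) H p
    rewrite H a (∨-trueˡ (≟ᵛ-refl a)) | H b (∨-trueʳ (a ≟ᵛ b) (≟ᵛ-refl b)) = p
  sat-agree (eq a b)   H p =
    trans (sym (H a (∨-trueˡ (≟ᵛ-refl a)))) (trans p (H b (∨-trueʳ (a ≟ᵛ b) (≟ᵛ-refl b))))
  sat-agree (φ ∧ᶠ ψ)   H (p , q) =
    sat-agree φ (λ z f → H z (∨-trueˡ f)) p , sat-agree ψ (λ z f → H z (∨-trueʳ (free φ z) f)) q
  sat-agree (φ ∨ᶠ ψ)   H (inj₁ p) = inj₁ (sat-agree φ (λ z f → H z (∨-trueˡ f)) p)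
  sat-agree (φ ∨ᶠ ψ)   H (inj₂ q) = inj₂ (sat-agree ψ (λ z f → H z (∨-trueʳ (free φ z) f)) q)
  sat-agree (ex a φ)   H (d , p) = d , sat-agree φ (update-agree a d φ H) p
  sat-agree (neg φ)    H ¬p p = ¬p (sat-agree φ (λ z f → sym (H z f)) p)

other : Var → Var
other vx = vy
other vy = vx

free-ex : ∀ {k} z (ψ : Fm k) v → free (ex z ψ) v ≡ true → v ≡ other z
free-ex vx ψ vy _ = refl
free-ex vy ψ vx _ = refl

-- The restriction on negation in the form used below: the truth of a negated formula depends on a
-- single variable. A closed formula gets `vy` by default.
free-neg : ∀ {k} (ψ : Fm k) → free ψ vx ∧ free ψ vy ≡ false →
  Σ Var λ z → ∀ v → free ψ v ≡ true → v ≡ z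
free-neg ψ p with free ψ vx in ex | free ψ vy in ey
... | true  | false = vx , λ { vx _ → refl ; vy q → ⊥-elim (true≢false (trans (sym q) ey)) }
... | false | _     = vy , λ { vx q → ⊥-elim (true≢false (trans (sym q) ex)) ; vy _ → refl }

-- Subformulas.

subs : ∀ {k} → Fm k → List (Fm k)
subs φ@(ψ ∧ᶠ χ) = φ ∷ subs ψ ++ subs χ
subs φ@(ψ ∨ᶠ χ) = φ ∷ subs ψ ++ subs χ
subs φ@(ex _ ψ) = φ ∷ subs ψ
subs φ@(neg ψ)  = φ ∷ subs ψ
subs φ@(B0 _)     = φ ∷ []
subs φ@(B1 _ _)   = φ ∷ []
subs φ@(B2 _ _ _) = φ ∷ []
subs φ@(TA _ _ _) = φ ∷ []
subs φ@(eq _ _)   = φ ∷ []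

length-subs : ∀ {k} (φ : Fm k) → length (subs φ) ≤ len φ
length-subs (B0 _)     = s≤s z≤n
length-subs (B1 _ _)   = s≤s z≤n
length-subs (B2 _ _ _) = s≤s z≤n
length-subs (TA _ _ _) = s≤s z≤n
length-subs (eq _ _)   = s≤s z≤n
length-subs (ψ ∧ᶠ χ) =
  s≤s (N.≤-trans (N.≤-reflexive (length-++ (subs ψ))) (N.+-mono-≤ (length-subs ψ) (length-subs χ)))
length-subs (ψ ∨ᶠ χ) =
  s≤s (N.≤-trans (N.≤-reflexive (length-++ (subs ψ))) (N.+-mono-≤ (length-subs ψ) (length-subs χ)))
length-subs (ex _ ψ) = s≤s (N.m≤n⇒m≤1+n (length-subs ψ))
length-subs (neg ψ)  = s≤s (length-subs ψ)

subs-refl : ∀ {k} (φ : Fm k) → φ ∈ subs φ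
subs-refl (B0 _)     = here refl
subs-refl (B1 _ _)   = here refl
subs-refl (B2 _ _ _) = here refl
subs-refl (TA _ _ _) = here refl
subs-refl (eq _ _)   = here refl
subs-refl (_ ∧ᶠ _)   = here refl
subs-refl (_ ∨ᶠ _)   = here refl
subs-refl (ex _ _)   = here refl
subs-refl (neg _)    = here refl

subs-trans : ∀ {k} (φ : Fm k) {ψ χ} → ψ ∈ subs φ → χ ∈ subs ψ → χ ∈ subs φ
subs-trans (B0 _)     (here refl) q = q
subs-trans (B1 _ _)   (here refl) q = q
subs-trans (B2 _ _ _) (here refl) q = q
subs-trans (TA _ _ _) (here refl) q = q
subs-trans (eq _ _)   (here refl) q = q
subs-trans (_ ∧ᶠ _)   (here refl) q = q
subs-trans (_ ∨ᶠ _)   (here refl) q = q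
subs-trans (ex _ _)   (here refl) q = q
subs-trans (neg _)    (here refl) q = q
subs-trans (φ ∧ᶠ φ′)  (there p) q with ∈-++⁻ (subs φ) p
... | inj₁ p′ = there (∈-++⁺ˡ (subs-trans φ p′ q))
... | inj₂ p′ = there (∈-++⁺ʳ (subs φ) (subs-trans φ′ p′ q))
subs-trans (φ ∨ᶠ φ′)  (there p) q with ∈-++⁻ (subs φ) p
... | inj₁ p′ = there (∈-++⁺ˡ (subs-trans φ p′ q))
... | inj₂ p′ = there (∈-++⁺ʳ (subs φ) (subs-trans φ′ p′ q))
subs-trans (ex _ φ)   (there p) q = there (subs-trans φ p q)
subs-trans (neg φ)    (there p) q = there (subs-trans φ p q)

-- Covers of a finite structure.

-- A finite structure over Fin size that looks locally like Fin nA: `down`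
-- and `up` are the two halves of the back-and-forth between pairs.
record Cover {nA K n Q : ℕ}
    (T : Fin K → Fin nA → Fin nA → Bool) (R : ℕ → Fin nA → Fin nA → Bool)
    (tp : Fin nA → Fin Q) (wit : Fin nA → Fin n → Fin nA) (size : ℕ) : Set where
  field
    point   : Fin size
    h       : Fin size → Fin nA
    TB      : Fin K → Fin size → Fin size → Bool
    RB      : ℕ → Fin size → Fin size → Bool
    TB-trans : ∀ u b c d → TB u b c ≡ true → TB u c d ≡ true → TB u b d ≡ true
    TB-diag : ∀ u b → TB u b b ≡ T u (h b) (h b)
    RB-diag : ∀ r b → RB r b b ≡ R r (h b) (h b)
    down    : ∀ b c → Σ (Fin nA) λ a → Σ (Fin nA) λ a′ →
              tp a ≡ tp (h b) × tp a′ ≡ tp (h c) × (b ≡ c → a ≡ a′) ×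
              (∀ r → RB r b c ≡ true → R r a a′ ≡ true) ×
              (∀ r → RB r c b ≡ true → R r a′ a ≡ true) ×
              (∀ u → TB u b c ≡ true → T u a a′ ≡ true) ×
              (∀ u → TB u c b ≡ true → T u a′ a ≡ true)
    up      : ∀ b i → let a = h b ; a′ = wit (h b) i in Σ (Fin size) λ c →
              tp a′ ≡ tp (h c) × (a ≡ a′ → b ≡ c) ×
              (∀ r → R r a a′ ≡ true → RB r b c ≡ true) ×
              (∀ r → R r a′ a ≡ true → RB r c b ≡ true) ×
              (∀ u → T u a a′ ≡ true → TB u b c ≡ true) ×
              (∀ u → T u a′ a ≡ true → TB u c b ≡ true)

-- Transitive relations are indexed by subformulas rather than by symbols, because the number `k` of
-- symbols is not bounded by the length of the formula. An atom stands for the forward symbol of its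
-- pair, whichever direction it mentions, and any other subformula for the empty relation.
TransRel : ∀ {k n} → Str k n → Fm k → Fin n → Fin n → Bool
TransRel S (TA (u , _) _ _) a b = RT S (u , fwd) a b
TransRel S _                _ _ = false

Concerns : ∀ {k} → Fin k → Fm k → Set
Concerns u (TA (v , _) _ _) = u ≡ v
Concerns u _                = ⊥

concerns? : ∀ {k} (u : Fin k) ψ → Dec (Concerns u ψ)
concerns? u (TA (v , _) _ _) = u F.≟ v
concerns? u (B0 _)     = no λ ()
concerns? u (B1 _ _)   = no λ ()
concerns? u (B2 _ _ _) = no λ ()
concerns? u (eq _ _)   = no λ ()
concerns? u (_ ∧ᶠ _)   = no λ ()
concerns? u (_ ∨ᶠ _)   = no λ ()
concerns? u (ex _ _)   = no λ ()
concerns? u (neg _)    = no λ ()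

concerns-rel : ∀ {k n} (S : Str k n) u ψ → Concerns u ψ → ∀ a b →
  TransRel S ψ a b ≡ RT S (u , fwd) a b
concerns-rel S u (TA (v , _) _ _) refl a b = refl

TransRel-trans : ∀ {k n} (S : Str k n) → Admissible S → ∀ ψ a b c →
  TransRel S ψ a b ≡ true → TransRel S ψ b c ≡ true → TransRel S ψ a c ≡ true
TransRel-trans S (tr , _) (TA (v , _) _ _) a b c = tr (v , fwd) a b c
TransRel-trans S _ (B0 _)     a b c ()
TransRel-trans S _ (B1 _ _)   a b c ()
TransRel-trans S _ (B2 _ _ _) a b c ()
TransRel-trans S _ (eq _ _)   a b c ()
TransRel-trans S _ (_ ∧ᶠ _)   a b c ()
TransRel-trans S _ (_ ∨ᶠ _)   a b c ()
TransRel-trans S _ (ex _ _)   a b c ()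
TransRel-trans S _ (neg _)    a b c ()

-- There is one demand per subformula. A slot that asks for nothing, or for something false at `a`,
-- is filled with `a` itself, so that the demands form a total function.
witness : ∀ {k n} → Str k n → Fm k → Fin n → Fin n
witness S (ex z ψ) a with sat? S (ex z ψ) (const a)
... | yes (d , _) = d
... | no _        = a
witness S _ a = a

witness-sat : ∀ {k n} (S : Str k n) z ψ a → S ⊨ ex z ψ [ const a ] →
  S ⊨ ψ [ update (const a) z (witness S (ex z ψ) a) ]
witness-sat S z ψ a p with sat? S (ex z ψ) (const a)
... | yes (d , q) = q
... | no ¬p       = ⊥-elim (¬p p)

Atomic : ∀ {k} → Fm k → Set
Atomic (_ ∧ᶠ _) = ⊥
Atomic (_ ∨ᶠ _) = ⊥
Atomic (ex _ _) = ⊥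
Atomic (neg _)  = ⊥
Atomic _        = ⊤

-- Transfer of formulas to a covering structure.

module Transfer {k nA : ℕ} (A : Str k nA) (adm : Admissible A) (φ₀ : Fm k)
  {Q : ℕ} (tp : Fin nA → Fin Q)
  (tp-sat : ∀ {a a′ ψ} → tp a ≡ tp a′ → ψ ∈ subs φ₀ → A ⊨ ψ [ const a ] → A ⊨ ψ [ const a′ ])
  {size : ℕ}
  (cov : Cover (λ j → TransRel A (lookup (subs φ₀) j)) (R2 A) tp
               (λ a j → witness A (lookup (subs φ₀) j) a) size)
  where

  open Cover cov

  Occurs : Fin k → Set
  Occurs u = ∃ λ j → Concerns u (lookup (subs φ₀) j)

  symbol? : ∀ u → Dec (Occurs u)
  symbol? u = F.any? (λ j → concerns? u (lookup (subs φ₀) j))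

  -- Several subformulas may mention the same symbol, and `symbol?` settles on one of them. The
  -- choice is immaterial: the relations of A at these indices coincide, and `down` and `up` speak
  -- of all indices. Symbols foreign to `φ₀` become empty.
  fwdT : Fin k → Fin size → Fin size → Bool
  fwdT u b c with symbol? u
  ... | yes (j , _) = TB j b c
  ... | no _        = false

  B : Str k size
  R0 B = R0 A
  R1 B r b = R1 A r (h b)
  R2 B = RB
  RT B (u , fwd) b c = fwdT u b c
  RT B (u , bwd) b c = fwdT u c b

  fwdT-trans : ∀ u b c d → fwdT u b c ≡ true → fwdT u c d ≡ true → fwdT u b d ≡ true
  fwdT-trans u b c d p q with symbol? u
  ... | yes (j , _) = TB-trans j b c d p q

  B-admissible : Admissible B
  B-admissible = trn , λ u a b → refl
    where
    trn : ∀ i a b c → RT B i a b ≡ true → RT B i b c ≡ true → RT B i a c ≡ true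
    trn (u , fwd) a b c p q = fwdT-trans u a b c p q
    trn (u , bwd) a b c p q = fwdT-trans u c b a q p

  fwdT-down : ∀ u {b c a a′} →
    (∀ j → TB j b c ≡ true → TransRel A (lookup (subs φ₀) j) a a′ ≡ true) →
    fwdT u b c ≡ true → RT A (u , fwd) a a′ ≡ true
  fwdT-down u {a = a} {a′} H p with symbol? u
  ... | yes (j , cj) = trans (sym (concerns-rel A u _ cj a a′)) (H j p)

  concerns-index : ∀ {u d v w} → TA (u , d) v w ∈ subs φ₀ → Occurs u
  concerns-index {u} m = index m , subst (Concerns u) (lookup-index m) refl

  fwdT-up : ∀ u {b c a a′} → Occurs u →
    (∀ j → TransRel A (lookup (subs φ₀) j) a a′ ≡ true → TB j b c ≡ true) →
    RT A (u , fwd) a a′ ≡ true → fwdT u b c ≡ true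
  fwdT-up u {a = a} {a′} m H p with symbol? u
  ... | yes (j , cj) = H j (trans (concerns-rel A u _ cj a a′) p)
  ... | no ¬m        = ⊥-elim (¬m m)

  bwdA : ∀ u a a′ → RT A (u , bwd) a a′ ≡ RT A (u , fwd) a′ a
  bwdA = proj₂ adm

  on-pairs : (P : Var → Var → Set) → (∀ v → P v v) → ∀ z → P (other z) z → P z (other z) →
    ∀ v w → P v w
  on-pairs P d vx p q vx vx = d vx
  on-pairs P d vx p q vx vy = q
  on-pairs P d vx p q vy vx = p
  on-pairs P d vx p q vy vy = d vy
  on-pairs P d vy p q vx vx = d vx
  on-pairs P d vy p q vx vy = p
  on-pairs P d vy p q vy vx = q
  on-pairs P d vy p q vy vy = d vy

  SameTypes : Asg nA → Asg size → Set
  SameTypes ρ σ = ∀ z → tp (ρ z) ≡ tp (h (σ z))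

  -- The two directions are kept apart: the image in A of a pair of B may satisfy more atoms than
  -- the pair, while a copied witness only has to keep the atoms it had in A.
  Up Down : Asg nA → Asg size → Set
  Up   ρ σ = ∀ {ψ} → ψ ∈ subs φ₀ → Atomic ψ → A ⊨ ψ [ ρ ] → B ⊨ ψ [ σ ]
  Down ρ σ = ∀ {ψ} → ψ ∈ subs φ₀ → Atomic ψ → B ⊨ ψ [ σ ] → A ⊨ ψ [ ρ ]

  up-from-pairs : ∀ ρ σ → SameTypes ρ σ →
    (∀ v w → ρ v ≡ ρ w → σ v ≡ σ w) →
    (∀ v w r → B2 r v w ∈ subs φ₀ → R2 A r (ρ v) (ρ w) ≡ true → RB r (σ v) (σ w) ≡ true) →
    (∀ v w u → Occurs u → (TA (u , fwd) v w ∈ subs φ₀ ⊎ TA (u , bwd) w v ∈ subs φ₀) →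
       RT A (u , fwd) (ρ v) (ρ w) ≡ true → fwdT u (σ v) (σ w) ≡ true) →
    Up ρ σ
  up-from-pairs ρ σ st e r t {B0 _}     m _ p = p
  up-from-pairs ρ σ st e r t {B1 s v}   m _ p = tp-sat (st v) m p
  up-from-pairs ρ σ st e r t {B2 s v w} m _ p = r v w s m p
  up-from-pairs ρ σ st e r t {TA (u , fwd) v w} m _ p = t v w u (concerns-index m) (inj₁ m) p
  up-from-pairs ρ σ st e r t {TA (u , bwd) v w} m _ p =
    t w v u (concerns-index m) (inj₂ m) (trans (sym (bwdA u _ _)) p)
  up-from-pairs ρ σ st e r t {eq v w}   m _ p = e v w p

  down-from-pairs : ∀ ρ σ → SameTypes ρ σ →
    (∀ v w → σ v ≡ σ w → ρ v ≡ ρ w) →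
    (∀ v w r → B2 r v w ∈ subs φ₀ → RB r (σ v) (σ w) ≡ true → R2 A r (ρ v) (ρ w) ≡ true) →
    (∀ v w u → (TA (u , fwd) v w ∈ subs φ₀ ⊎ TA (u , bwd) w v ∈ subs φ₀) →
       fwdT u (σ v) (σ w) ≡ true → RT A (u , fwd) (ρ v) (ρ w) ≡ true) →
    Down ρ σ
  down-from-pairs ρ σ st e r t {B0 _}     m _ p = p
  down-from-pairs ρ σ st e r t {B1 s v}   m _ p = tp-sat (sym (st v)) m p
  down-from-pairs ρ σ st e r t {B2 s v w} m _ p = r v w s m p
  down-from-pairs ρ σ st e r t {TA (u , fwd) v w} m _ p = t v w u (inj₁ m) p
  down-from-pairs ρ σ st e r t {TA (u , bwd) v w} m _ p =
    trans (bwdA u _ _) (t w v u (inj₂ m) p)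
  down-from-pairs ρ σ st e r t {eq v w}   m _ p = e v w p

  refl-tp : ∀ {a a′ u v} → tp a ≡ tp a′ → (TA (u , fwd) v v ∈ subs φ₀ ⊎ TA (u , bwd) v v ∈ subs φ₀) →
    RT A (u , fwd) a a ≡ true → RT A (u , fwd) a′ a′ ≡ true
  refl-tp e (inj₁ m) p = tp-sat e m p
  refl-tp {a} {a′} {u} e (inj₂ m) p =
    trans (sym (bwdA u a′ a′)) (tp-sat e m (trans (bwdA u a a) p))

  up-diagR : ∀ (ρ : Asg nA) σ → SameTypes ρ σ → ∀ r v → B2 r v v ∈ subs φ₀ →
    R2 A r (ρ v) (ρ v) ≡ true → RB r (σ v) (σ v) ≡ true
  up-diagR ρ σ st r v m p = trans (RB-diag r _) (tp-sat (st v) m p)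

  up-diagT : ∀ (ρ : Asg nA) σ → SameTypes ρ σ → ∀ u v → Occurs u →
    (TA (u , fwd) v v ∈ subs φ₀ ⊎ TA (u , bwd) v v ∈ subs φ₀) →
    RT A (u , fwd) (ρ v) (ρ v) ≡ true → fwdT u (σ v) (σ v) ≡ true
  up-diagT ρ σ st u v c m p =
    fwdT-up u c (λ j q → trans (TB-diag j _) q) (refl-tp (st v) m p)

  -- When both variables denote the same point, every atom of `φ₀` is decided by the type of that
  -- point, so equality of types alone suffices.
  up-diag : ∀ a b → tp a ≡ tp (h b) → Up (const a) (const b)
  up-diag a b e = up-from-pairs (const a) (const b) (λ _ → e) (λ _ _ _ → refl)
    (λ v w r m p → trans (RB-diag r b) (tp-sat e m p))
    (λ v w u c m p → fwdT-up u c (λ j q → trans (TB-diag j _) q) (r-tp v w u m p))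
    where
    r-tp : ∀ v w u → (TA (u , fwd) v w ∈ subs φ₀ ⊎ TA (u , bwd) w v ∈ subs φ₀) →
      RT A (u , fwd) a a ≡ true → RT A (u , fwd) (h b) (h b) ≡ true
    r-tp v w u (inj₁ m) p = tp-sat e m p
    r-tp v w u (inj₂ m) p = trans (sym (bwdA u _ _)) (tp-sat e m (trans (bwdA u a a) p))

  down-diag : ∀ a b → tp a ≡ tp (h b) → Down (const a) (const b)
  down-diag a b e = down-from-pairs (const a) (const b) (λ _ → e) (λ _ _ _ → refl)
    (λ v w r m p → tp-sat (sym e) m (trans (sym (RB-diag r b)) p))
    (λ v w u m p → r-tp v w u m (fwdT-down u (λ j q → trans (sym (TB-diag j b)) q) p))
    where
    r-tp : ∀ v w u → (TA (u , fwd) v w ∈ subs φ₀ ⊎ TA (u , bwd) w v ∈ subs φ₀) →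
      RT A (u , fwd) (h b) (h b) ≡ true → RT A (u , fwd) a a ≡ true
    r-tp v w u (inj₁ m) p = tp-sat (sym e) m p
    r-tp v w u (inj₂ m) p = trans (sym (bwdA u _ _)) (tp-sat (sym e) m (trans (bwdA u _ _) p))

  down-any : ∀ σ → Σ (Asg nA) λ ρ → SameTypes ρ σ × Down ρ σ
  down-any σ with down (σ vx) (σ vy)
  ... | a , a′ , ea , ea′ , e , r₁ , r₂ , t₁ , t₂ =
    ρ , st , down-from-pairs ρ σ st
      (on-pairs _ (λ v _ → refl) vy e (λ q → sym (e (sym q))))
      (on-pairs _ (λ v r m p → tp-sat (sym (st v)) m (trans (sym (RB-diag r _)) p)) vy
         (λ r _ → r₁ r) (λ r _ → r₂ r))
      (on-pairs _ (λ v u m p → refl-tp (sym (st v)) m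
                     (fwdT-down u (λ j q → trans (sym (TB-diag j _)) q) p)) vy
         (λ u _ → fwdT-down u t₁) (λ u _ → fwdT-down u t₂))
    where
    ρ : Asg nA
    ρ vx = a
    ρ vy = a′
    st : SameTypes ρ σ
    st vx = ea
    st vy = ea′

  -- The cover copies the witnesses of `h b` only, so the truth of an existential formula has to be
  -- moved to `h b` before a witness can be taken.
  up-wit : ∀ z ψ b → ex z ψ ∈ subs φ₀ → A ⊨ ex z ψ [ const (h b) ] →
    Σ (Asg nA) λ ρ → Σ (Fin size) λ c →
      SameTypes ρ (update (const b) z c) × Up ρ (update (const b) z c) × (A ⊨ ψ [ ρ ])
  up-wit z ψ b m p with index m | lookup-index m | up b (index m)
  ... | j | j-eq | c , tc , e , r₁ , r₂ , t₁ , t₂ rewrite sym j-eq =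
    ρ , c , st z , up-from-pairs ρ σ (st z)
      (on-pairs _ (λ v _ → refl) z (eqs z) (λ q → sym (eqs z (sym q))))
      (on-pairs _ (λ v r → up-diagR ρ σ (st z) r v) z (λ r _ → R₁ z r) (λ r _ → R₂ z r))
      (on-pairs _ (λ v u → up-diagT ρ σ (st z) u v) z
         (λ u k _ → T₁ z u k) (λ u k _ → T₂ z u k))
    , witness-sat A z ψ a p
    where
    a = h b
    a′ = witness A (ex z ψ) a
    ρ = update (const a) z a′
    σ = update (const b) z c
    st : ∀ z → SameTypes (update (const a) z a′) (update (const b) z c)
    st vx vx = tc
    st vx vy = refl
    st vy vx = refl
    st vy vy = tc
    eqs : ∀ z → update (const a) z a′ (other z) ≡ update (const a) z a′ z →
      update (const b) z c (other z) ≡ update (const b) z c z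
    eqs vx = e
    eqs vy = e
    R₁ : ∀ z r → R2 A r (update (const a) z a′ (other z)) (update (const a) z a′ z) ≡ true →
      RB r (update (const b) z c (other z)) (update (const b) z c z) ≡ true
    R₁ vx = r₁
    R₁ vy = r₁
    R₂ : ∀ z r → R2 A r (update (const a) z a′ z) (update (const a) z a′ (other z)) ≡ true →
      RB r (update (const b) z c z) (update (const b) z c (other z)) ≡ true
    R₂ vx = r₂
    R₂ vy = r₂
    T₁ : ∀ z u → Occurs u →
      RT A (u , fwd) (update (const a) z a′ (other z)) (update (const a) z a′ z) ≡ true →
      fwdT u (update (const b) z c (other z)) (update (const b) z c z) ≡ true
    T₁ vx u k = fwdT-up u k t₁
    T₁ vy u k = fwdT-up u k t₁
    T₂ : ∀ z u → Occurs u →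
      RT A (u , fwd) (update (const a) z a′ z) (update (const a) z a′ (other z)) ≡ true →
      fwdT u (update (const b) z c z) (update (const b) z c (other z)) ≡ true
    T₂ vx u k = fwdT-up u k t₂
    T₂ vy u k = fwdT-up u k t₂

  child : ∀ {ψ χ} → ψ ∈ subs φ₀ → χ ∈ subs ψ → χ ∈ subs φ₀
  child = subs-trans φ₀

  update-other : ∀ {n} (σ : Asg n) z c v → update (const (σ (other z))) z c v ≡ update σ z c v
  update-other σ vx c vx = refl
  update-other σ vx c vy = refl
  update-other σ vy c vx = refl
  update-other σ vy c vy = refl

  agree-at : ∀ {n} {ψ : Fm k} {z} (ρ ρ′ : Asg n) → (∀ v → free ψ v ≡ true → v ≡ z) →
    ρ z ≡ ρ′ z → ∀ v → free ψ v ≡ true → ρ v ≡ ρ′ v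
  agree-at ρ ρ′ only e v f rewrite only v f = e

  -- Simultaneous induction on the formula. Negation exchanges the two directions. This is possible
  -- because the negated formula sees only one variable: once the assignments are collapsed to it,
  -- both `Up` and `Down` follow from equality of types.
  pull : ∀ ψ → ψ ∈ subs φ₀ → IsUNFO ψ → ∀ {ρ σ} → SameTypes ρ σ → Down ρ σ →
    B ⊨ ψ [ σ ] → A ⊨ ψ [ ρ ]
  push : ∀ ψ → ψ ∈ subs φ₀ → IsUNFO ψ → ∀ {ρ σ} → SameTypes ρ σ → Up ρ σ →
    A ⊨ ψ [ ρ ] → B ⊨ ψ [ σ ]

  pull ψ@(B0 _)     m _ st d p = d m tt p
  pull ψ@(B1 _ _)   m _ st d p = d m tt p
  pull ψ@(B2 _ _ _) m _ st d p = d m tt p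
  pull ψ@(TA _ _ _) m _ st d p = d m tt p
  pull ψ@(eq _ _)   m _ st d p = d m tt p
  pull (ψ ∧ᶠ χ) m (i , j) st d (p , q) =
    pull ψ (child m (there (∈-++⁺ˡ (subs-refl ψ)))) i st d p ,
    pull χ (child m (there (∈-++⁺ʳ (subs ψ) (subs-refl χ)))) j st d q
  pull (ψ ∨ᶠ χ) m (i , j) st d (inj₁ p) =
    inj₁ (pull ψ (child m (there (∈-++⁺ˡ (subs-refl ψ)))) i st d p)
  pull (ψ ∨ᶠ χ) m (i , j) st d (inj₂ q) =
    inj₂ (pull χ (child m (there (∈-++⁺ʳ (subs ψ) (subs-refl χ)))) j st d q)
  pull (ex z ψ) m i {ρ} {σ} st d (c , p) with down-any (update σ z c)
  ... | ρ′ , st′ , d′ =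
    -- The pair found for `update σ z c` shares with `ρ` only the type at the remaining variable.
    -- This suffices, as `ex z ψ` has no other free variable and its truth is recorded in the types.
    sat-agree A (ex z ψ) (agree-at {ψ = ex z ψ} (const (ρ (other z))) ρ (free-ex z ψ) refl)
      (tp-sat (trans (st′ (other z)) (trans (cong (tp ∘ h) (upd-other z)) (sym (st (other z))))) m
        (sat-agree A (ex z ψ) (agree-at {ψ = ex z ψ} ρ′ (const (ρ′ (other z))) (free-ex z ψ) refl)
          (ρ′ z , sat-agree A ψ (λ v _ → upd-self z v)
            (pull ψ (child m (there (subs-refl ψ))) i st′ d′ p))))
    where
    upd-other : ∀ z → update σ z c (other z) ≡ σ (other z)
    upd-other vx = refl
    upd-other vy = refl
    upd-self : ∀ z v → ρ′ v ≡ update ρ′ z (ρ′ z) v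
    upd-self vx vx = refl
    upd-self vx vy = refl
    upd-self vy vx = refl
    upd-self vy vy = refl
  pull (neg ψ) m (f , i) {ρ} {σ} st d ¬p p with free-neg ψ f
  ... | z , only = ¬p
    (sat-agree B ψ (agree-at {ψ = ψ} (const (σ z)) σ only refl)
      (push ψ (child m (there (subs-refl ψ))) i (λ _ → st z) (up-diag (ρ z) (σ z) (st z))
        (sat-agree A ψ (agree-at {ψ = ψ} ρ (const (ρ z)) only refl) p)))

  push ψ@(B0 _)     m _ st d p = d m tt p
  push ψ@(B1 _ _)   m _ st d p = d m tt p
  push ψ@(B2 _ _ _) m _ st d p = d m tt p
  push ψ@(TA _ _ _) m _ st d p = d m tt p
  push ψ@(eq _ _)   m _ st d p = d m tt p
  push (ψ ∧ᶠ χ) m (i , j) st d (p , q) =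
    push ψ (child m (there (∈-++⁺ˡ (subs-refl ψ)))) i st d p ,
    push χ (child m (there (∈-++⁺ʳ (subs ψ) (subs-refl χ)))) j st d q
  push (ψ ∨ᶠ χ) m (i , j) st d (inj₁ p) =
    inj₁ (push ψ (child m (there (∈-++⁺ˡ (subs-refl ψ)))) i st d p)
  push (ψ ∨ᶠ χ) m (i , j) st d (inj₂ q) =
    inj₂ (push χ (child m (there (∈-++⁺ʳ (subs ψ) (subs-refl χ)))) j st d q)
  push (ex z ψ) m i {ρ} {σ} st d p
    with up-wit z ψ (σ (other z)) m
           (tp-sat (st (other z)) m
             (sat-agree A (ex z ψ) (agree-at {ψ = ex z ψ} ρ (const (ρ (other z))) (free-ex z ψ) refl) p))
  ... | ρ′ , c , st′ , u′ , q =
    c , sat-agree B ψ (λ v _ → update-other σ z c v)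
          (push ψ (child m (there (subs-refl ψ))) i st′ u′ q)
  push (neg ψ) m (f , i) {ρ} {σ} st d ¬p p with free-neg ψ f
  ... | z , only = ¬p
    (sat-agree A ψ (agree-at {ψ = ψ} (const (ρ z)) ρ only refl)
      (pull ψ (child m (there (subs-refl ψ))) i (λ _ → st z) (down-diag (ρ z) (σ z) (st z))
        (sat-agree B ψ (agree-at {ψ = ψ} σ (const (σ z)) only refl) p)))

  sentence-transfer : IsUNFO φ₀ → (∀ a → A ⊨ φ₀ [ const a ]) → B ⊨ φ₀ [ const point ]
  sentence-transfer i H =
    push φ₀ (subs-refl φ₀) i (λ _ → refl) (up-diag (h point) point refl) (H (h point))

-- Finite sets as numbers, and signed relations.

does⇒ : ∀ {P : Set} (d : Dec P) → does d ≡ true → P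
does⇒ (yes p) _ = p

⇒does : ∀ {P : Set} (d : Dec P) → P → does d ≡ true
⇒does (yes _) _ = refl
⇒does (no ¬p) p = ⊥-elim (¬p p)

⇔⇒≡ : ∀ {a b} → (a ≡ true → b ≡ true) → (b ≡ true → a ≡ true) → a ≡ b
⇔⇒≡ {true}  {b}     f g = sym (f refl)
⇔⇒≡ {false} {true}  f g = g refl
⇔⇒≡ {false} {false} f g = refl

bit : Bool → Fin 2
bit true  = suc zero
bit false = zero

unbit : Fin 2 → Bool
unbit zero    = false
unbit (suc _) = true

unbit-bit : ∀ b → unbit (bit b) ≡ b
unbit-bit true  = refl
unbit-bit false = refl

mem : ∀ {k} → Fin (2 ^ k) → Fin k → Bool
mem {k} S s = unbit (finToFun {2} {k} S s)

⟪_⟫ : ∀ {k} → (Fin k → Bool) → Fin (2 ^ k)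
⟪ f ⟫ = funToFin (bit ∘ f)

mem-⟪⟫ : ∀ {k} (f : Fin k → Bool) s → mem ⟪ f ⟫ s ≡ f s
mem-⟪⟫ f s = trans (cong unbit (F.finToFun-funToFin (bit ∘ f) s)) (unbit-bit (f s))

-- The second half of the indices reads the relations backwards, so that a set of signed symbols can
-- describe all transitive atoms of a pair, in both directions.
signed : ∀ {K} {X : Set} → (Fin K → X → X → Bool) → Fin (K + K) → X → X → Bool
signed {K} T s a b = [ (λ u → T u a b) , (λ u → T u b a) ]′ (splitAt K s)

signed-ˡ : ∀ {K} {X : Set} (T : Fin K → X → X → Bool) u a b → signed T (u ↑ˡ K) a b ≡ T u a b
signed-ˡ {K} T u a b rewrite F.splitAt-↑ˡ K u K = refl

signed-ʳ : ∀ {K} {X : Set} (T : Fin K → X → X → Bool) u a b → signed T (K ↑ʳ u) a b ≡ T u b a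
signed-ʳ {K} T u a b rewrite F.splitAt-↑ʳ K K u = refl

-- Label graphs.

-- A finite graph with vertex labels in the structure: the edge (l , i) goes
-- from l to tgt l i and carries the atoms of the pair lab l, wit (lab l) i.
-- P S l l′ says that l′ may be reached from l inside all relations in S.
record LabelGraph {nA K n Q : ℕ} (T : Fin K → Fin nA → Fin nA → Bool)
    (tp : Fin nA → Fin Q) (wit : Fin nA → Fin n → Fin nA) (N : ℕ) : Set₁ where
  field
    start    : Fin N
    lab      : Fin N → Fin nA
    tgt      : Fin N → Fin n → Fin N
    tgt-tp   : ∀ l i → tp (wit (lab l) i) ≡ tp (lab (tgt l i))
    rank     : Fin K → Fin N → ℕ
    rank-fwd : ∀ u l i → T u (lab l) (wit (lab l) i) ≡ true → T u (wit (lab l) i) (lab l) ≡ false →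
               rank u l < rank u (tgt l i)
    rank-bwd : ∀ u l i → T u (lab l) (wit (lab l) i) ≡ false → T u (wit (lab l) i) (lab l) ≡ true →
               rank u (tgt l i) < rank u l
    rank-eq  : ∀ u l i → T u (lab l) (wit (lab l) i) ≡ true → T u (wit (lab l) i) (lab l) ≡ true →
               rank u l ≡ rank u (tgt l i)
    P        : Fin (2 ^ (K + K)) → Fin N → Fin N → Set
    P?       : ∀ S l l′ → Dec (P S l l′)
    P-trans  : ∀ S {l₁ l₂ l₃} → P S l₁ l₂ → P S l₂ l₃ → P S l₁ l₃
    P-out    : ∀ S l i → (∀ s → mem S s ≡ true → signed T s (lab l) (wit (lab l) i) ≡ true) →
               P S l (tgt l i)
    P-in     : ∀ S l i → (∀ s → mem S s ≡ true → signed T s (wit (lab l) i) (lab l) ≡ true) →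
               P S (tgt l i) l
    P-real   : ∀ S l l′ → P S l l′ → Σ (Fin nA) λ a → tp a ≡ tp (lab l′) ×
               (∀ s → mem S s ≡ true → signed T s (lab l) a ≡ true)

-- Integers and sums modulo m.

module Congruence (m : ℕ) where

  infix 4 _≈_
  record _≈_ (x y : ℤ) : Set where
    constructor mk≈
    field m∣ : + m ∣ (x ℤ.- y)
  open _≈_ public

  abstract
    ≈-dec : ∀ x y → Dec (x ≈ y)
    ≈-dec x y with + m ∣? (x ℤ.- y)
    ... | yes p = yes (mk≈ p)
    ... | no ¬p = no (¬p ∘ m∣)

  ≡⇒≈ : ∀ {x y} → x ≡ y → x ≈ y
  ≡⇒≈ {x} refl = mk≈ (subst (+ m ∣_) (sym (Z.+-inverseʳ x)) (divides 0ℤ refl))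

  ≈-refl : ∀ {x} → x ≈ x
  ≈-refl = ≡⇒≈ refl

  ≈-sym : ∀ {x y} → x ≈ y → y ≈ x
  ≈-sym {x} {y} (mk≈ p) = mk≈ (subst (+ m ∣_) (lem x y) (∣m⇒∣-m p))
    where lem : ∀ x y → ℤ.- (x ℤ.- y) ≡ y ℤ.- x
          lem = solve-∀

  ≈-trans : ∀ {x y z} → x ≈ y → y ≈ z → x ≈ z
  ≈-trans {x} {y} {z} (mk≈ p) (mk≈ q) = mk≈ (subst (+ m ∣_) (lem x y z) (∣m∣n⇒∣m+n p q))
    where lem : ∀ x y z → (x ℤ.- y) ℤ.+ (y ℤ.- z) ≡ x ℤ.- z
          lem = solve-∀

  +-cong-≈ : ∀ {x y z w} → x ≈ y → z ≈ w → x ℤ.+ z ≈ y ℤ.+ w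
  +-cong-≈ {x} {y} {z} {w} (mk≈ p) (mk≈ q) = mk≈ (subst (+ m ∣_) (lem x y z w) (∣m∣n⇒∣m+n p q))
    where lem : ∀ x y z w → (x ℤ.- y) ℤ.+ (z ℤ.- w) ≡ (x ℤ.+ z) ℤ.- (y ℤ.+ w)
          lem = solve-∀

  *-congʳ-≈ : ∀ {x y} w → x ≈ y → x ℤ.* w ≈ y ℤ.* w
  *-congʳ-≈ {x} {y} w (mk≈ p) = mk≈ (subst (+ m ∣_) (lem x y w) (∣m⇒∣m*n w p))
    where lem : ∀ x y w → (x ℤ.- y) ℤ.* w ≡ x ℤ.* w ℤ.- y ℤ.* w
          lem = solve-∀

  +-cancelˡ-≈ : ∀ x {y z} → x ℤ.+ y ≈ x ℤ.+ z → y ≈ z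
  +-cancelˡ-≈ x {y} {z} (mk≈ p) = mk≈ (subst (+ m ∣_) (lem x y z) p)
    where lem : ∀ x y z → (x ℤ.+ y) ℤ.- (x ℤ.+ z) ≡ y ℤ.- z
          lem = solve-∀

  small≉0 : ∀ q → suc q < m → ¬ (+ suc q ≈ 0ℤ)
  small≉0 q q<m (mk≈ p) = ND.>⇒∤ q<m (∣⇒∣ᵤ (subst (+ m ∣_) (lem (+ suc q)) p))
    where lem : ∀ x → x ℤ.- 0ℤ ≡ x
          lem = solve-∀

  x≉x+1 : 1 < m → ∀ {x y} → y ≈ x ℤ.+ 1ℤ → ¬ (y ≈ x)
  x≉x+1 1<m {x} p q = small≉0 0 1<m
    (+-cancelˡ-≈ x (≈-trans (≈-sym p) (≈-trans q (≡⇒≈ (sym (Z.+-identityʳ x))))))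

  -- Modulo `m > 2` going up by one differs from going down by one; thus a step can be told from its
  -- reversal.
  x≉x+2 : 2 < m → ∀ {x y} → y ≈ x ℤ.+ 1ℤ → ¬ (x ≈ y ℤ.+ 1ℤ)
  x≉x+2 2<m {x} {y} p q = small≉0 1 2<m
    (+-cancelˡ-≈ x (≈-trans (≡⇒≈ (sym (Z.+-assoc x 1ℤ 1ℤ)))
      (≈-trans (+-cong-≈ (≈-sym p) ≈-refl) (≈-trans (≈-sym q) (≡⇒≈ (sym (Z.+-identityʳ x)))))))

  sum-cong-≈ : ∀ {n} {f g : Fin n → ℤ} → (∀ e → f e ≈ g e) → sum f ≈ sum g
  sum-cong-≈ {zero}  H = ≈-refl
  sum-cong-≈ {suc n} H = +-cong-≈ (H zero) (sum-cong-≈ (H ∘ suc))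

  sum-bump : ∀ {n} {f g : Fin n → ℤ} e₀ w → (∀ e → e ≢ e₀ → g e ≈ f e) → g e₀ ≈ f e₀ ℤ.+ w →
    sum g ≈ sum f ℤ.+ w
  sum-bump {f = f} zero w H p =
    ≈-trans (+-cong-≈ p (sum-cong-≈ (λ e → H (suc e) λ ())))
            (≡⇒≈ (lem (f zero) w (sum (f ∘ suc))))
    where lem : ∀ x y z → (x ℤ.+ y) ℤ.+ z ≡ (x ℤ.+ z) ℤ.+ y
          lem = solve-∀
  sum-bump {f = f} (suc e₀) w H p =
    ≈-trans (+-cong-≈ (H zero λ ()) (sum-bump e₀ w (λ e ne → H (suc e) (ne ∘ F.suc-injective)) p))
            (≡⇒≈ (sym (Z.+-assoc (f zero) (sum (f ∘ suc)) w)))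

  -- Each summand loses 0 or 1, so the total loss is represented by a genuine number up to `n` and
  -- not just by a residue.
  sum-decrease : ∀ {n} {f g : Fin n → ℤ} → (∀ e → g e ≈ f e ⊎ f e ≈ g e ℤ.+ 1ℤ) →
    ∃ λ q → q ≤ n × sum f ≈ sum g ℤ.+ + q
  sum-decrease {zero} H = 0 , z≤n , ≈-refl
  sum-decrease {suc n} {f} {g} H with sum-decrease (H ∘ suc) | H zero
  ... | q , q≤n , p | inj₁ e = q , N.m≤n⇒m≤1+n q≤n ,
    ≈-trans (+-cong-≈ (≈-sym e) p) (≡⇒≈ (sym (Z.+-assoc (g zero) (sum (g ∘ suc)) (+ q))))
  ... | q , q≤n , p | inj₂ e = suc q , s≤s q≤n ,
    ≈-trans (+-cong-≈ e p) (≡⇒≈ (lem (g zero) (sum (g ∘ suc)) (+ q)))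
    where lem : ∀ x y z → (x ℤ.+ 1ℤ) ℤ.+ (y ℤ.+ z) ≡ (x ℤ.+ y) ℤ.+ (1ℤ ℤ.+ z)
          lem = solve-∀

-- Unfolding a label graph into a cover.

module Construction {nA K n Q N : ℕ}
  (T : Fin K → Fin nA → Fin nA → Bool) (R : ℕ → Fin nA → Fin nA → Bool)
  (tp : Fin nA → Fin Q) (wit : Fin nA → Fin n → Fin nA)
  (T-trans : ∀ u a b c → T u a b ≡ true → T u b c ≡ true → T u a c ≡ true)
  (tp-refl : ∀ u {a a′} → tp a ≡ tp a′ → T u a a ≡ true → T u a′ a′ ≡ true)
  (G : LabelGraph T tp wit N)
  where

  open LabelGraph G

  E m size : ℕ
  E = N * n
  -- The cut argument uses `m > E + 1`; telling a step from its reversal uses `m > 2`.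
  m = 3 + E
  size = N * m ^ E

  open Congruence m

  1<m : 1 < m
  1<m = s≤s (s≤s z≤n)

  2<m : 2 < m
  2<m = s≤s (s≤s (s≤s z≤n))

  src : Fin E → Fin N
  src e = proj₁ (remQuot n e)

  dst : Fin E → Fin N
  dst e = tgt (src e) (proj₂ (remQuot {N} n e))

  fst snd : Fin E → Fin nA
  fst e = lab (src e)
  snd e = wit (lab (src e)) (proj₂ (remQuot {N} n e))

  edge : Fin N → Fin n → Fin E
  edge l i = combine l i

  vert : Fin size → Fin N
  vert b = proj₁ (remQuot {N} (m ^ E) b)

  digit : Fin size → Fin E → Fin m
  digit b = finToFun (proj₂ (remQuot {N} (m ^ E) b))

  cnt : Fin size → Fin E → ℤ
  cnt b e = + toℕ (digit b e)

  mkB : Fin N → (Fin E → Fin m) → Fin size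
  mkB l g = combine l (funToFin g)

  vert-mkB : ∀ l g → vert (mkB l g) ≡ l
  vert-mkB l g = cong proj₁ (F.remQuot-combine l (funToFin g))

  digit-mkB : ∀ l g e → digit (mkB l g) e ≡ g e
  digit-mkB l g e = trans (cong (λ p → finToFun (proj₂ p) e) (F.remQuot-combine l (funToFin g)))
                          (F.finToFun-funToFin g e)

  inc : Fin m → Fin m
  inc x = fromℕ< (m%n<n (suc (toℕ x)) m)

  inc-≈ : ∀ x → + toℕ (inc x) ≈ + toℕ x ℤ.+ 1ℤ
  inc-≈ x = mk≈ (divides (ℤ.- (+ q)) eq′)
    where
    y = suc (toℕ x)
    q = y / m
    lem : ∀ a b → a ℤ.- (a ℤ.+ b) ≡ ℤ.- b
    lem = solve-∀
    open ≡-Reasoning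
    eq′ : + toℕ (inc x) ℤ.- (+ toℕ x ℤ.+ 1ℤ) ≡ (ℤ.- (+ q)) ℤ.* + m
    eq′ = begin
      + toℕ (inc x) ℤ.- (+ toℕ x ℤ.+ 1ℤ)
        ≡⟨ cong₂ (λ a b → + a ℤ.- b) (F.toℕ-fromℕ< (m%n<n y m)) (Z.+-comm (+ toℕ x) 1ℤ) ⟩
      + (y % m) ℤ.- + y
        ≡⟨ cong (λ z → + (y % m) ℤ.- + z) (m≡m%n+[m/n]*n y m) ⟩
      + (y % m) ℤ.- + (y % m + q * m)
        ≡⟨ cong (λ z → + (y % m) ℤ.- z)
             (trans (Z.pos-+ (y % m) (q * m)) (cong (λ z → + (y % m) ℤ.+ z) (Z.pos-* q m))) ⟩
      + (y % m) ℤ.- (+ (y % m) ℤ.+ + q ℤ.* + m)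
        ≡⟨ lem (+ (y % m)) (+ q ℤ.* + m) ⟩
      ℤ.- (+ q ℤ.* + m)
        ≡⟨ Z.neg-distribˡ-* (+ q) (+ m) ⟩
      (ℤ.- (+ q)) ℤ.* + m ∎

  bump : Fin E → (Fin E → Fin m) → Fin E → Fin m
  bump e₀ g e with e F.≟ e₀
  ... | yes _ = inc (g e)
  ... | no _  = g e

  step : Fin size → Fin n → Fin size
  step b i = mkB (tgt (vert b) i) (bump (edge (vert b) i) (digit b))

  record Step (b : Fin size) (i : Fin n) (c : Fin size) : Set where
    field
      at-tgt : vert c ≡ tgt (vert b) i
      same   : ∀ e → e ≢ edge (vert b) i → cnt c e ≈ cnt b e
      bumped : cnt c (edge (vert b) i) ≈ cnt b (edge (vert b) i) ℤ.+ 1ℤ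
  open Step

  step-Step : ∀ b i → Step b i (step b i)
  step-Step b i = record
    { at-tgt = vert-mkB _ _
    ; same   = λ e ne → ≡⇒≈ (cong (+_ ∘ toℕ) (trans (digit-mkB _ _ e) (bump-no e ne)))
    ; bumped = subst (λ d → + toℕ d ≈ cnt b e₀ ℤ.+ 1ℤ)
                 (sym (trans (digit-mkB _ _ e₀) bump-yes)) (inc-≈ (digit b e₀)) }
    where
    e₀ = edge (vert b) i
    bump-no : ∀ e → e ≢ e₀ → bump e₀ (digit b) e ≡ digit b e
    bump-no e ne with e F.≟ e₀
    ... | yes p = ⊥-elim (ne p)
    ... | no _  = refl
    bump-yes : bump e₀ (digit b) e₀ ≡ inc (digit b e₀)
    bump-yes with e₀ F.≟ e₀
    ... | yes _ = refl
    ... | no ¬p = ⊥-elim (¬p refl)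

  src-edge : ∀ l i → src (edge l i) ≡ l
  src-edge l i = cong proj₁ (F.remQuot-combine l i)

  idx-edge : ∀ l i → proj₂ (remQuot {N} n (edge l i)) ≡ i
  idx-edge l i = cong proj₂ (F.remQuot-combine l i)

  dst-edge : ∀ l i → dst (edge l i) ≡ tgt l i
  dst-edge l i = cong₂ tgt (src-edge l i) (idx-edge l i)

  fst-edge : ∀ l i → fst (edge l i) ≡ lab l
  fst-edge l i = cong lab (src-edge l i)

  snd-edge : ∀ l i → snd (edge l i) ≡ wit (lab l) i
  snd-edge l i = cong₂ (λ l i → wit (lab l) i) (src-edge l i) (idx-edge l i)

  -- `P` need not be reflexive, so the starting vertex is added by hand.
  Reach : Fin (2 ^ (K + K)) → Fin N → Fin N → Set
  Reach S l₁ v = v ≡ l₁ ⊎ P S l₁ v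

  reach? : ∀ S l₁ v → Dec (Reach S l₁ v)
  reach? S l₁ v = (v F.≟ l₁) ⊎-dec P? S l₁ v

  ind : ∀ {X : Set} → Dec X → ℤ
  ind (yes _) = 1ℤ
  ind (no _)  = 0ℤ

  -- The coboundary of the indicator of the reach set: 1 on edges leaving it, -1 on edges entering
  -- it, 0 on all others.
  weight : Fin (2 ^ (K + K)) → Fin N → Fin E → ℤ
  weight S l₁ e = ind (reach? S l₁ (src e)) ℤ.- ind (reach? S l₁ (dst e))

  -- Counting edge traversals modulo m turns walks into flows; the net flow out
  -- of the vertex set Reach S l₁ makes Φ S l₁ invariant along every step.
  Φ : Fin (2 ^ (K + K)) → Fin N → Fin size → ℤ
  Φ S l₁ b = ind (reach? S l₁ (vert b)) ℤ.+ sum (λ e → cnt b e ℤ.* weight S l₁ e)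

  -- The traversed edge changes the sum by its weight, the indicator at the source minus that at the
  -- target, and the leading term changes by the opposite amount.
  Φ-step : ∀ S l₁ b i c → Step b i c → Φ S l₁ c ≈ Φ S l₁ b
  Φ-step S l₁ b i c st =
    ≈-trans (+-cong-≈ (≡⇒≈ (cong χ (at-tgt st)))
              (sum-bump e₀ (weight S l₁ e₀) (λ e ne → *-congʳ-≈ _ (same st e ne))
                (≈-trans (*-congʳ-≈ _ (bumped st)) (≡⇒≈ (lem₁ (cnt b e₀) (weight S l₁ e₀))))))
            (≡⇒≈ (trans (cong₂ (λ x y → χ (tgt (vert b) i) ℤ.+ (s ℤ.+ (χ x ℤ.- χ y)))
                               (src-edge (vert b) i) (dst-edge (vert b) i))
                        (lem₂ (χ (tgt (vert b) i)) s (χ (vert b)))))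
    where
    e₀ = edge (vert b) i
    χ : Fin N → ℤ
    χ v = ind (reach? S l₁ v)
    s = sum (λ e → cnt b e ℤ.* weight S l₁ e)
    lem₁ : ∀ x w → (x ℤ.+ 1ℤ) ℤ.* w ≡ x ℤ.* w ℤ.+ w
    lem₁ = solve-∀
    lem₂ : ∀ x s y → x ℤ.+ (s ℤ.+ (y ℤ.- x)) ≡ y ℤ.+ s
    lem₂ = solve-∀

  Ranked : Fin K → Fin N → Fin N → Set
  Ranked u l l′ = rank u l < rank u l′ ⊎
    (rank u l ≡ rank u l′ × T u (lab l) (lab l) ≡ true × T u (lab l′) (lab l′) ≡ true)

  -- How often an edge with endpoints of rank s and t may be counted along a
  -- walk from rank r to rank r′ inside one relation; the Booleans tell whether
  -- the relation holds along the edge and against it.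
  Shift : Bool → Bool → (x y : ℤ) (r r′ s t : ℕ) → Set
  Shift true  true  x y r r′ s t = ⊤
  Shift true  false x y r r′ s t = y ≈ x ⊎ (y ≈ x ℤ.+ 1ℤ × r ≤ s × t ≤ r′)
  Shift false true  x y r r′ s t = y ≈ x ⊎ (x ≈ y ℤ.+ 1ℤ × r ≤ t × s ≤ r′)
  Shift false false x y r r′ s t = y ≈ x

  shift? : ∀ p q x y r r′ s t → Dec (Shift p q x y r r′ s t)
  shift? true  true  x y r r′ s t = yes tt
  shift? true  false x y r r′ s t =
    ≈-dec y x ⊎-dec (≈-dec y (x ℤ.+ 1ℤ) ×-dec ((r N.≤? s) ×-dec (t N.≤? r′)))
  shift? false true  x y r r′ s t =
    ≈-dec y x ⊎-dec (≈-dec x (y ℤ.+ 1ℤ) ×-dec ((r N.≤? t) ×-dec (s N.≤? r′)))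
  shift? false false x y r r′ s t = ≈-dec y x

  shift-same : ∀ p q {x y r r′ s t} → y ≈ x → Shift p q x y r r′ s t
  shift-same true  true  e = tt
  shift-same true  false e = inj₁ e
  shift-same false true  e = inj₁ e
  shift-same false false e = e

  ShiftAt : Fin K → Fin size → Fin size → Fin E → Set
  ShiftAt u b c e = Shift (T u (fst e) (snd e)) (T u (snd e) (fst e)) (cnt b e) (cnt c e)
    (rank u (vert b)) (rank u (vert c)) (rank u (src e)) (rank u (dst e))

  -- A decidable upper approximation of the transitive closure of the steps inside `T u`: each of
  -- the three conditions holds for such a step and is inherited by compositions.
  TRel : Fin K → Fin size → Fin size → Set
  TRel u b c = Ranked u (vert b) (vert c) × (∀ e → ShiftAt u b c e) ×
    (∀ S l₁ → Φ S l₁ b ≈ Φ S l₁ c)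

  abstract
    tRel? : ∀ u b c → Dec (TRel u b c)
    tRel? u b c =
      ((rank u (vert b) N.<? rank u (vert c)) ⊎-dec
        ((rank u (vert b) N.≟ rank u (vert c)) ×-dec
          ((T u (lab (vert b)) (lab (vert b)) Bo.≟ true) ×-dec
           (T u (lab (vert c)) (lab (vert c)) Bo.≟ true))))
      ×-dec (F.all? (λ e → shift? (T u (fst e) (snd e)) (T u (snd e) (fst e)) (cnt b e) (cnt c e)
                      (rank u (vert b)) (rank u (vert c)) (rank u (src e)) (rank u (dst e)))
      ×-dec F.all? (λ S → F.all? (λ l₁ → ≈-dec (Φ S l₁ b) (Φ S l₁ c))))

  ranked-≤ : ∀ {u l l′} → Ranked u l l′ → rank u l ≤ rank u l′
  ranked-≤ (inj₁ p)       = N.<⇒≤ p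
  ranked-≤ (inj₂ (p , _)) = N.≤-reflexive p

  ranked-trans : ∀ {u l₁ l₂ l₃} → Ranked u l₁ l₂ → Ranked u l₂ l₃ → Ranked u l₁ l₃
  ranked-trans (inj₁ p) q = inj₁ (N.<-≤-trans p (ranked-≤ q))
  ranked-trans (inj₂ (p , _)) (inj₁ q) = inj₁ (N.≤-<-trans (N.≤-reflexive p) q)
  ranked-trans (inj₂ (p , t , _)) (inj₂ (q , _ , t′)) = inj₂ (trans p q , t , t′)

  -- The critical case is a one-way edge counted in both halves. The first half ends no lower than
  -- the upper end of the edge and the second starts no higher than its lower end, although ranks
  -- grow strictly along the edge.
  shift-trans : ∀ p q {x y z r₁ r₂ r₃ s t} → r₁ ≤ r₂ → r₂ ≤ r₃ →
    (p ≡ true → q ≡ false → s < t) → (p ≡ false → q ≡ true → t < s) →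
    Shift p q x y r₁ r₂ s t → Shift p q y z r₂ r₃ s t → Shift p q x z r₁ r₃ s t
  shift-trans true true _ _ _ _ _ _ = tt
  shift-trans true false a b lt _ (inj₁ e) (inj₁ f) = inj₁ (≈-trans f e)
  shift-trans true false a b lt _ (inj₁ e) (inj₂ (f , i , j)) =
    inj₂ (≈-trans f (+-cong-≈ e ≈-refl) , N.≤-trans a i , j)
  shift-trans true false a b lt _ (inj₂ (e , i , j)) (inj₁ f) =
    inj₂ (≈-trans f e , i , N.≤-trans j b)
  shift-trans true false a b lt _ (inj₂ (e , i , j)) (inj₂ (f , i′ , j′)) =
    ⊥-elim (N.<⇒≱ (lt refl refl) (N.≤-trans j i′))
  shift-trans false true a b _ gt (inj₁ e) (inj₁ f) = inj₁ (≈-trans f e)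
  shift-trans false true a b _ gt (inj₁ e) (inj₂ (f , i , j)) =
    inj₂ (≈-trans (≈-sym e) f , N.≤-trans a i , j)
  shift-trans false true a b _ gt (inj₂ (e , i , j)) (inj₁ f) =
    inj₂ (≈-trans e (+-cong-≈ (≈-sym f) ≈-refl) , i , N.≤-trans j b)
  shift-trans false true a b _ gt (inj₂ (e , i , j)) (inj₂ (f , i′ , j′)) =
    ⊥-elim (N.<⇒≱ (gt refl refl) (N.≤-trans j i′))
  shift-trans false false _ _ _ _ e f = ≈-trans f e

  tRel-trans : ∀ u b c d → TRel u b c → TRel u c d → TRel u b d
  tRel-trans u b c d (p , f , x) (q , g , y) =
    ranked-trans p q ,
    (λ e → shift-trans (T u (fst e) (snd e)) (T u (snd e) (fst e)) (ranked-≤ p) (ranked-≤ q)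
             (rank-fwd u _ _) (rank-bwd u _ _) (f e) (g e)) ,
    (λ S l₁ → ≈-trans (x S l₁) (y S l₁))

  tRel-refl : ∀ u b → T u (lab (vert b)) (lab (vert b)) ≡ true → TRel u b b
  tRel-refl u b t = inj₂ (refl , t , t) ,
    (λ e → shift-same (T u (fst e) (snd e)) (T u (snd e) (fst e)) ≈-refl) , (λ S l₁ → ≈-refl)

  tRel-refl⁻ : ∀ u b c → vert b ≡ vert c → TRel u b c → T u (lab (vert b)) (lab (vert b)) ≡ true
  tRel-refl⁻ u b c e (inj₁ p , _) = ⊥-elim (N.<-irrefl (cong (rank u) e) p)
  tRel-refl⁻ u b c e (inj₂ (_ , t , _) , _) = t

  loops : ∀ u l i → T u (lab l) (wit (lab l) i) ≡ true → T u (wit (lab l) i) (lab l) ≡ true →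
    T u (lab l) (lab l) ≡ true × T u (lab (tgt l i)) (lab (tgt l i)) ≡ true
  loops u l i p q = T-trans u _ _ _ p q , tp-refl u (tgt-tp l i) (T-trans u _ _ _ q p)

  ranked-out : ∀ u l i → T u (lab l) (wit (lab l) i) ≡ true → Ranked u l (tgt l i)
  ranked-out u l i p with T u (wit (lab l) i) (lab l) in q
  ... | false = inj₁ (rank-fwd u l i p q)
  ... | true  = inj₂ (rank-eq u l i p q , loops u l i p q)

  ranked-in : ∀ u l i → T u (wit (lab l) i) (lab l) ≡ true → Ranked u (tgt l i) l
  ranked-in u l i q with T u (lab l) (wit (lab l) i) in p
  ... | false = inj₁ (rank-bwd u l i p q)
  ... | true  = inj₂ (sym (rank-eq u l i p q) , proj₂ (loops u l i p q) , proj₁ (loops u l i p q))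

  tRel-out : ∀ u b i c → Step b i c → T u (lab (vert b)) (wit (lab (vert b)) i) ≡ true → TRel u b c
  tRel-out u b i c st t =
    subst (Ranked u (vert b)) (sym (at-tgt st)) (ranked-out u (vert b) i t) ,
    sh , (λ S l₁ → ≈-sym (Φ-step S l₁ b i c st))
    where
    e₀ = edge (vert b) i
    own : ∀ p q → p ≡ true → Shift p q (cnt b e₀) (cnt c e₀)
            (rank u (vert b)) (rank u (vert c)) (rank u (src e₀)) (rank u (dst e₀))
    own true true  _ = tt
    own true false _ = inj₂ (bumped st ,
      N.≤-reflexive (cong (rank u) (sym (src-edge (vert b) i))) ,
      N.≤-reflexive (cong (rank u) (trans (dst-edge (vert b) i) (sym (at-tgt st)))))
    sh : ∀ e → ShiftAt u b c e
    sh e with e F.≟ e₀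
    ... | no ne = shift-same (T u (fst e) (snd e)) (T u (snd e) (fst e)) (same st e ne)
    ... | yes refl = own (T u (fst e) (snd e)) (T u (snd e) (fst e))
      (trans (cong₂ (T u) (fst-edge (vert b) i) (snd-edge (vert b) i)) t)

  tRel-in : ∀ u b i c → Step b i c → T u (wit (lab (vert b)) i) (lab (vert b)) ≡ true → TRel u c b
  tRel-in u b i c st t =
    subst (λ l → Ranked u l (vert b)) (sym (at-tgt st)) (ranked-in u (vert b) i t) ,
    sh , (λ S l₁ → Φ-step S l₁ b i c st)
    where
    e₀ = edge (vert b) i
    own : ∀ p q → q ≡ true → Shift p q (cnt c e₀) (cnt b e₀)
            (rank u (vert c)) (rank u (vert b)) (rank u (src e₀)) (rank u (dst e₀))
    own true  true _ = tt
    own false true _ = inj₂ (bumped st ,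
      N.≤-reflexive (cong (rank u) (sym (trans (dst-edge (vert b) i) (sym (at-tgt st))))) ,
      N.≤-reflexive (cong (rank u) (src-edge (vert b) i)))
    sh : ∀ e → ShiftAt u c b e
    sh e with e F.≟ e₀
    ... | no ne = shift-same (T u (fst e) (snd e)) (T u (snd e) (fst e)) (≈-sym (same st e ne))
    ... | yes refl = own (T u (fst e) (snd e)) (T u (snd e) (fst e))
      (trans (cong₂ (T u) (snd-edge (vert b) i) (fst-edge (vert b) i)) t)

  -- The counter of the traversed edge has gone up by one. If `T u` failed along the edge, `Shift`
  -- would only let it stay or go down by one, and both are excluded modulo `m`.
  tRel-out⁻ : ∀ u b i c → Step b i c → TRel u b c → T u (lab (vert b)) (wit (lab (vert b)) i) ≡ true
  tRel-out⁻ u b i c st (_ , sh , _) =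
    trans (sym (cong₂ (T u) (fst-edge (vert b) i) (snd-edge (vert b) i)))
          (own (T u (fst e₀) (snd e₀)) (T u (snd e₀) (fst e₀)) (sh e₀))
    where
    e₀ = edge (vert b) i
    own : ∀ p q {r r′ s t} → Shift p q (cnt b e₀) (cnt c e₀) r r′ s t → p ≡ true
    own true  q     _ = refl
    own false true  (inj₁ e) = ⊥-elim (x≉x+1 1<m (bumped st) e)
    own false true  (inj₂ (e , _)) = ⊥-elim (x≉x+2 2<m (bumped st) e)
    own false false e = ⊥-elim (x≉x+1 1<m (bumped st) e)

  tRel-in⁻ : ∀ u b i c → Step b i c → TRel u c b → T u (wit (lab (vert b)) i) (lab (vert b)) ≡ true
  tRel-in⁻ u b i c st (_ , sh , _) =
    trans (sym (cong₂ (T u) (snd-edge (vert b) i) (fst-edge (vert b) i)))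
          (own (T u (fst e₀) (snd e₀)) (T u (snd e₀) (fst e₀)) (sh e₀))
    where
    e₀ = edge (vert b) i
    own : ∀ p q {r r′ s t} → Shift p q (cnt c e₀) (cnt b e₀) r r′ s t → q ≡ true
    own p     true  _ = refl
    own true  false (inj₁ e) = ⊥-elim (x≉x+1 1<m (bumped st) (≈-sym e))
    own true  false (inj₂ (e , _)) = ⊥-elim (x≉x+2 2<m (bumped st) e)
    own false false e = ⊥-elim (x≉x+1 1<m (bumped st) (≈-sym e))

  Both : Fin (K + K) → Fin size → Fin size → Set
  Both s b c = [ (λ u → TRel u b c) , (λ u → TRel u c b) ]′ (splitAt K s)

  both-Φ : ∀ s b c → Both s b c → ∀ S l₁ → Φ S l₁ b ≈ Φ S l₁ c
  both-Φ s b c t S l₁ with splitAt K s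
  ... | inj₁ u = proj₂ (proj₂ t) S l₁
  ... | inj₂ u = ≈-sym (proj₂ (proj₂ t) S l₁)

  -- A single relation failing along `e` keeps the counter of `e` from going up, and the counters
  -- are shared by all relations. Hence only edges lying in every member of a set of relations can
  -- be counted forwards.
  not-out : ∀ s b c e → Both s b c → signed T s (fst e) (snd e) ≡ false →
    cnt c e ≈ cnt b e ⊎ cnt b e ≈ cnt c e ℤ.+ 1ℤ
  not-out s b c e t f with splitAt K s
  ... | inj₁ u = own (T u (fst e) (snd e)) (T u (snd e) (fst e)) f (proj₁ (proj₂ t) e)
    where
    own : ∀ p q {r r′ v w} → p ≡ false → Shift p q (cnt b e) (cnt c e) r r′ v w →
      cnt c e ≈ cnt b e ⊎ cnt b e ≈ cnt c e ℤ.+ 1ℤ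
    own false true  _ (inj₁ x)       = inj₁ x
    own false true  _ (inj₂ (x , _)) = inj₂ x
    own false false _ x              = inj₁ x
  ... | inj₂ u = own (T u (fst e) (snd e)) (T u (snd e) (fst e)) f (proj₁ (proj₂ t) e)
    where
    own : ∀ p q {r r′ v w} → q ≡ false → Shift p q (cnt c e) (cnt b e) r r′ v w →
      cnt c e ≈ cnt b e ⊎ cnt b e ≈ cnt c e ℤ.+ 1ℤ
    own true  false _ (inj₁ x)       = inj₁ (≈-sym x)
    own true  false _ (inj₂ (x , _)) = inj₂ x
    own false false _ x              = inj₁ (≈-sym x)

  not-in : ∀ s b c e → Both s b c → signed T s (snd e) (fst e) ≡ false →
    cnt c e ≈ cnt b e ⊎ cnt c e ≈ cnt b e ℤ.+ 1ℤ
  not-in s b c e t f with splitAt K s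
  ... | inj₁ u = own (T u (fst e) (snd e)) (T u (snd e) (fst e)) f (proj₁ (proj₂ t) e)
    where
    own : ∀ p q {r r′ v w} → q ≡ false → Shift p q (cnt b e) (cnt c e) r r′ v w →
      cnt c e ≈ cnt b e ⊎ cnt c e ≈ cnt b e ℤ.+ 1ℤ
    own true  false _ (inj₁ x)       = inj₁ x
    own true  false _ (inj₂ (x , _)) = inj₂ x
    own false false _ x              = inj₁ x
  ... | inj₂ u = own (T u (fst e) (snd e)) (T u (snd e) (fst e)) f (proj₁ (proj₂ t) e)
    where
    own : ∀ p q {r r′ v w} → p ≡ false → Shift p q (cnt c e) (cnt b e) r r′ v w →
      cnt c e ≈ cnt b e ⊎ cnt c e ≈ cnt b e ℤ.+ 1ℤ
    own false true  _ (inj₁ x)       = inj₁ (≈-sym x)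
    own false true  _ (inj₂ (x , _)) = inj₂ x
    own false false _ x              = inj₁ (≈-sym x)

  refuter : ∀ S a a′ → ¬ (∀ s → mem S s ≡ true → signed T s a a′ ≡ true) →
    ∃ λ s → mem S s ≡ true × signed T s a a′ ≡ false
  refuter S a a′ ¬all with F.any? (λ s → (mem S s Bo.≟ true) ×-dec (signed T s a a′ Bo.≟ false))
  ... | yes p = p
  ... | no ¬p = ⊥-elim (¬all λ s ms → holds s ms)
    where
    holds : ∀ s → mem S s ≡ true → signed T s a a′ ≡ true
    holds s ms with signed T s a a′ in eq′
    ... | true  = refl
    ... | false = ⊥-elim (¬p (s , ms , eq′))

  -- If vert c were outside Reach S (vert b), each edge crossing the cut would
  -- be counted at most once, inwards: at most E units flow in, although one
  -- unit flows out modulo m > E + 1.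
  cut : ∀ S b c → (∀ s → mem S s ≡ true → Both s b c) → (∃ λ s → mem S s ≡ true) →
    Reach S (vert b) (vert c)
  cut S b c sound (s₀ , ms₀) with reach? S (vert b) (vert c) in rc
  ... | yes p = p
  ... | no ¬p = ⊥-elim absurd
    where
    l₁ = vert b
    f g : Fin E → ℤ
    f e = cnt b e ℤ.* weight S l₁ e
    g e = cnt c e ℤ.* weight S l₁ e
    close : ∀ {x y} → Reach S l₁ x → P S x y → Reach S l₁ y
    close (inj₁ refl) q = inj₂ q
    close (inj₂ p) q = inj₂ (P-trans S p q)
    *0 : ∀ x y → x ℤ.* (1ℤ ℤ.- 1ℤ) ≈ y ℤ.* (1ℤ ℤ.- 1ℤ)
    *0 x y = ≡⇒≈ (trans (Z.*-zeroʳ x) (sym (Z.*-zeroʳ y)))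
    *1 : ∀ x → x ℤ.* (1ℤ ℤ.- 0ℤ) ≈ x
    *1 x = ≡⇒≈ (Z.*-identityʳ x)
    neg1 : ∀ {x y} → y ≈ x ℤ.+ 1ℤ → x ℤ.* (0ℤ ℤ.- 1ℤ) ≈ y ℤ.* (0ℤ ℤ.- 1ℤ) ℤ.+ 1ℤ
    neg1 {x} {y} p = ≈-trans (≡⇒≈ (lem x))
      (+-cong-≈ (*-congʳ-≈ (0ℤ ℤ.- 1ℤ) (≈-sym p)) ≈-refl)
      where lem : ∀ x → x ℤ.* (0ℤ ℤ.- 1ℤ) ≡ (x ℤ.+ 1ℤ) ℤ.* (0ℤ ℤ.- 1ℤ) ℤ.+ 1ℤ
            lem = solve-∀
    crossing : ∀ e → g e ≈ f e ⊎ f e ≈ g e ℤ.+ 1ℤ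
    crossing e with reach? S l₁ (src e) | reach? S l₁ (dst e)
    ... | yes _ | yes _ = inj₁ (*0 (cnt c e) (cnt b e))
    ... | no _  | no _  = inj₁ (*0 (cnt c e) (cnt b e))
    -- An edge leaving the reach set violates some member of `S`, since otherwise `P-out` would put
    -- its target into the set.
    ... | yes p | no ¬q with refuter S (fst e) (snd e) (λ H → ¬q (close p (P-out S _ _ H)))
    ...   | s , ms , ff with not-out s b c e (sound s ms) ff
    ...     | inj₁ x = inj₁ (*-congʳ-≈ _ x)
    ...     | inj₂ x = inj₂ (≈-trans (*1 (cnt b e)) (≈-trans x (+-cong-≈ (≈-sym (*1 (cnt c e))) ≈-refl)))
    crossing e | no ¬p | yes q with refuter S (snd e) (fst e) (λ H → ¬p (close q (P-in S _ _ H)))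
    ...   | s , ms , ff with not-in s b c e (sound s ms) ff
    ...     | inj₁ x = inj₁ (*-congʳ-≈ _ x)
    ...     | inj₂ x = inj₂ (neg1 {cnt b e} {cnt c e} x)
    start-in : ind (reach? S l₁ (vert b)) ≡ 1ℤ
    start-in with reach? S l₁ (vert b)
    ... | yes _ = refl
    ... | no ¬q = ⊥-elim (¬q (inj₁ refl))
    -- One member of `S` is enough to compare the invariants, whence the nonemptiness assumption.
    -- The indicator is 1 at `b` and 0 at `c`.
    flow : 1ℤ ℤ.+ sum f ≈ 0ℤ ℤ.+ sum g
    flow = subst₂ (λ x y → x ℤ.+ sum f ≈ y ℤ.+ sum g) start-in (cong ind rc)
             (both-Φ s₀ b c (sound s₀ ms₀) S l₁)
    shuffle : ∀ x y → x ℤ.+ (1ℤ ℤ.+ y) ≡ 1ℤ ℤ.+ (x ℤ.+ y)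
    shuffle = solve-∀
    absurd : ⊥
    absurd with sum-decrease crossing
    -- The two congruences combine to `suc q ≈ 0`, but `suc q` lies strictly between 0 and `m`.
    ... | q , q≤E , p = small≉0 q (s≤s (s≤s (N.m≤n⇒m≤1+n q≤E)))
      (+-cancelˡ-≈ (sum g) {+ suc q} {0ℤ} (≈-trans (≡⇒≈ (shuffle (sum g) (+ q)))
        (≈-trans (+-cong-≈ (≈-refl {1ℤ}) (≈-sym p)) (≈-trans flow (≡⇒≈ (Z.+-comm 0ℤ (sum g)))))))

  -- Base relations are placed on loops and single steps only, so that any other pair has nothing
  -- but transitive atoms to match.
  RRel : ℕ → Fin size → Fin size → Set
  RRel r b c =
    (b ≡ c × R r (lab (vert b)) (lab (vert b)) ≡ true) ⊎
    (∃ λ i → c ≡ step b i × R r (lab (vert b)) (wit (lab (vert b)) i) ≡ true) ⊎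
    (∃ λ j → b ≡ step c j × R r (wit (lab (vert c)) j) (lab (vert c)) ≡ true)

  abstract
    rRel? : ∀ r b c → Dec (RRel r b c)
    rRel? r b c =
      ((b F.≟ c) ×-dec (R r (lab (vert b)) (lab (vert b)) Bo.≟ true)) ⊎-dec
      (F.any? (λ i → (c F.≟ step b i) ×-dec (R r (lab (vert b)) (wit (lab (vert b)) i) Bo.≟ true)) ⊎-dec
       F.any? (λ j → (b F.≟ step c j) ×-dec (R r (wit (lab (vert c)) j) (lab (vert c)) Bo.≟ true)))

  as-Step : ∀ {b i c} → c ≡ step b i → Step b i c
  as-Step {b} {i} refl = step-Step b i

  step-irrefl : ∀ {b i} → ¬ Step b i b
  step-irrefl st = x≉x+1 1<m (bumped st) ≈-refl

  step-asym : ∀ {b i c j} → Step b i c → ¬ Step c j b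
  step-asym {b} {i} {c} {j} st st′ with edge (vert b) i F.≟ edge (vert c) j
  ... | yes e = x≉x+2 2<m (bumped st) (subst (λ e → cnt b e ≈ cnt c e ℤ.+ 1ℤ) (sym e) (bumped st′))
  ... | no ne = x≉x+1 1<m (bumped st) (≈-sym (same st′ _ ne))

  -- Only the counter of the traversed edge changes, so the two points reveal which edge was taken,
  -- and the base atoms of a step can be read back unambiguously.
  step-injective : ∀ {b i c j} → Step b i c → Step b j c → i ≡ j
  step-injective {b} {i} {c} {j} st st′ with edge (vert b) i F.≟ edge (vert b) j
  ... | yes e = proj₂ (F.combine-injective (vert b) i (vert b) j e)
  ... | no ne = ⊥-elim (x≉x+1 1<m (bumped st) (same st′ _ ne))

  rRel-refl⁻ : ∀ r b → RRel r b b → R r (lab (vert b)) (lab (vert b)) ≡ true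
  rRel-refl⁻ r b (inj₁ (_ , p)) = p
  rRel-refl⁻ r b (inj₂ (inj₁ (i , e , _))) = ⊥-elim (step-irrefl (as-Step e))
  rRel-refl⁻ r b (inj₂ (inj₂ (i , e , _))) = ⊥-elim (step-irrefl (as-Step e))

  rRel-out⁻ : ∀ r {b i c} → Step b i c → RRel r b c → R r (lab (vert b)) (wit (lab (vert b)) i) ≡ true
  rRel-out⁻ r st (inj₁ (refl , _)) = ⊥-elim (step-irrefl st)
  rRel-out⁻ r st (inj₂ (inj₁ (j , e , p))) with step-injective st (as-Step e)
  ... | refl = p
  rRel-out⁻ r st (inj₂ (inj₂ (j , e , p))) = ⊥-elim (step-asym st (as-Step e))

  rRel-in⁻ : ∀ r {b i c} → Step b i c → RRel r c b → R r (wit (lab (vert b)) i) (lab (vert b)) ≡ true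
  rRel-in⁻ r st (inj₁ (refl , _)) = ⊥-elim (step-irrefl st)
  rRel-in⁻ r st (inj₂ (inj₁ (j , e , p))) = ⊥-elim (step-asym st (as-Step e))
  rRel-in⁻ r st (inj₂ (inj₂ (j , e , p))) with step-injective st (as-Step e)
  ... | refl = p

  h : Fin size → Fin nA
  h b = lab (vert b)

  TB : Fin K → Fin size → Fin size → Bool
  TB u b c = does (tRel? u b c)

  RB : ℕ → Fin size → Fin size → Bool
  RB r b c = does (rRel? r b c)

  Match : Fin size → Fin size → Set
  Match b c = Σ (Fin nA) λ a → Σ (Fin nA) λ a′ →
    tp a ≡ tp (h b) × tp a′ ≡ tp (h c) × (b ≡ c → a ≡ a′) ×
    (∀ r → RB r b c ≡ true → R r a a′ ≡ true) ×
    (∀ r → RB r c b ≡ true → R r a′ a ≡ true) ×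
    (∀ u → TB u b c ≡ true → T u a a′ ≡ true) ×
    (∀ u → TB u c b ≡ true → T u a′ a ≡ true)

  match-sym : ∀ {b c} → Match b c → Match c b
  match-sym (a , a′ , p , q , e , r₁ , r₂ , t₁ , t₂) =
    a′ , a , q , p , (λ x → sym (e (sym x))) , r₂ , r₁ , t₂ , t₁

  match-refl : ∀ b → Match b b
  match-refl b = h b , h b , refl , refl , (λ _ → refl) , r , r , t , t
    where
    r : ∀ r → RB r b b ≡ true → R r (h b) (h b) ≡ true
    r r p = rRel-refl⁻ r b (does⇒ (rRel? r b b) p)
    t : ∀ u → TB u b b ≡ true → T u (h b) (h b) ≡ true
    t u p = tRel-refl⁻ u b b refl (does⇒ (tRel? u b b) p)

  match-step : ∀ {b i c} → Step b i c → Match b c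
  match-step {b} {i} {c} st =
    h b , wit (h b) i , refl , trans (tgt-tp (vert b) i) (cong (tp ∘ lab) (sym (at-tgt st))) ,
    (λ { refl → ⊥-elim (step-irrefl st) }) ,
    (λ r p → rRel-out⁻ r st (does⇒ (rRel? r b c) p)) ,
    (λ r p → rRel-in⁻ r st (does⇒ (rRel? r c b) p)) ,
    (λ u p → tRel-out⁻ u b i c st (does⇒ (tRel? u b c) p)) ,
    (λ u p → tRel-in⁻ u b i c st (does⇒ (tRel? u c b) p))

  -- `S` collects all transitive atoms of the pair with their directions. The cut argument gives
  -- reachability inside `S`, and `P-real` turns it into an element of A standing in all these
  -- relations to `h b`.
  match-far : ∀ {b c} → b ≢ c → (∀ i → c ≢ step b i) → (∀ j → b ≢ step c j) → Match b c
  match-far {b} {c} b≢c no-out no-in = found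
    where
    S = ⟪ (λ s → signed TB s b c) ⟫

    sound : ∀ s → mem S s ≡ true → Both s b c
    sound s ms with splitAt K s | trans (sym (mem-⟪⟫ (λ s → signed TB s b c) s)) ms
    ... | inj₁ u | t = does⇒ (tRel? u b c) t
    ... | inj₂ u | t = does⇒ (tRel? u c b) t

    no-R : ∀ r → ¬ RRel r b c
    no-R r (inj₁ (e , _)) = b≢c e
    no-R r (inj₂ (inj₁ (i , e , _))) = no-out i e
    no-R r (inj₂ (inj₂ (j , e , _))) = no-in j e

    no-R′ : ∀ r → ¬ RRel r c b
    no-R′ r (inj₁ (e , _)) = b≢c (sym e)
    no-R′ r (inj₂ (inj₁ (i , e , _))) = no-in i e
    no-R′ r (inj₂ (inj₂ (j , e , _))) = no-out j e

    from : ∀ a′ → tp a′ ≡ tp (h c) → (∀ s → mem S s ≡ true → signed T s (h b) a′ ≡ true) → Match b c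
    from a′ e H = h b , a′ , refl , e , (λ p → ⊥-elim (b≢c p)) ,
      (λ r p → ⊥-elim (no-R r (does⇒ (rRel? r b c) p))) ,
      (λ r p → ⊥-elim (no-R′ r (does⇒ (rRel? r c b) p))) ,
      (λ u p → trans (sym (signed-ˡ T u (h b) a′))
        (H (u ↑ˡ K) (trans (mem-⟪⟫ (λ s → signed TB s b c) (u ↑ˡ K)) (trans (signed-ˡ TB u b c) p)))) ,
      (λ u p → trans (sym (signed-ʳ T u (h b) a′))
        (H (K ↑ʳ u) (trans (mem-⟪⟫ (λ s → signed TB s b c) (K ↑ʳ u)) (trans (signed-ʳ TB u b c) p))))

    loop : vert c ≡ vert b → ∀ s → Both s b c → signed T s (h b) (h b) ≡ true
    loop e s t with splitAt K s
    ... | inj₁ u = tRel-refl⁻ u b c (sym e) t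
    ... | inj₂ u = subst (λ l → T u (lab l) (lab l) ≡ true) e (tRel-refl⁻ u c b e t)

    found : Match b c
    found with F.any? (λ s → mem S s Bo.≟ true)
    -- Without transitive atoms the two labels themselves form an image.
    ... | no none = from (h c) refl (λ s ms → ⊥-elim (none (s , ms)))
    ... | yes some with cut S b c sound some
    -- Distinct points over one vertex are both sent to `h b`; the equal-rank case of `Ranked`
    -- provides the loops.
    ...   | inj₁ e = from (h b) (cong (tp ∘ lab) (sym e)) (λ s ms → loop e s (sound s ms))
    ...   | inj₂ p with P-real S (vert b) (vert c) p
    ...     | a′ , e , H = from a′ e H

  match : ∀ b c → Match b c
  match b c = by (b F.≟ c) (F.any? (λ i → c F.≟ step b i)) (F.any? (λ j → b F.≟ step c j))
    where
    by : Dec (b ≡ c) → Dec (∃ λ i → c ≡ step b i) → Dec (∃ λ j → b ≡ step c j) → Match b c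
    by (yes e) _ _ = subst (Match b) e (match-refl b)
    by (no _) (yes (i , e)) _ = match-step (as-Step e)
    by (no _) (no _) (yes (j , e)) = match-sym (match-step (as-Step e))
    by (no b≢c) (no no-out) (no no-in) =
      match-far b≢c (λ i e → no-out (i , e)) (λ j e → no-in (j , e))

  TB-diag : ∀ u b → TB u b b ≡ T u (h b) (h b)
  TB-diag u b = ⇔⇒≡ (λ p → tRel-refl⁻ u b b refl (does⇒ (tRel? u b b) p))
                    (λ p → ⇒does (tRel? u b b) (tRel-refl u b p))

  RB-diag : ∀ r b → RB r b b ≡ R r (h b) (h b)
  RB-diag r b = ⇔⇒≡ (λ p → rRel-refl⁻ r b (does⇒ (rRel? r b b) p))
                    (λ p → ⇒does (rRel? r b b) (inj₁ (refl , p)))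

  cover : Cover T R tp wit size
  cover = record
    { point = mkB start (λ _ → zero)
    ; h = h ; TB = TB ; RB = RB
    ; TB-trans = λ u b c d p q → ⇒does (tRel? u b d)
        (tRel-trans u b c d (does⇒ (tRel? u b c) p) (does⇒ (tRel? u c d) q))
    ; TB-diag = TB-diag ; RB-diag = RB-diag
    ; down = match
    ; up = λ b i → respond b i (h b F.≟ wit (h b) i) }
    where
    Response : Fin size → Fin nA → Set
    Response b a′ = Σ (Fin size) λ c → tp a′ ≡ tp (h c) × (h b ≡ a′ → b ≡ c) ×
      (∀ r → R r (h b) a′ ≡ true → RB r b c ≡ true) ×
      (∀ r → R r a′ (h b) ≡ true → RB r c b ≡ true) ×
      (∀ u → T u (h b) a′ ≡ true → TB u b c ≡ true) ×
      (∀ u → T u a′ (h b) ≡ true → TB u c b ≡ true)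

    stay : ∀ b → Response b (h b)
    stay b = b , refl , (λ _ → refl) ,
      (λ r p → trans (RB-diag r b) p) , (λ r p → trans (RB-diag r b) p) ,
      (λ u p → trans (TB-diag u b) p) , (λ u p → trans (TB-diag u b) p)

    respond : ∀ b i → Dec (h b ≡ wit (h b) i) → Response b (wit (h b) i)
    -- Equality has to be preserved, so a demand that `h b` meets by itself is answered by `b`.
    respond b i (yes e) = subst (Response b) e (stay b)
    respond b i (no ne) = step b i , trans (tgt-tp (vert b) i) (cong (tp ∘ lab) (sym (at-tgt st))) ,
      (λ p → ⊥-elim (ne p)) ,
      (λ r p → ⇒does (rRel? r b (step b i)) (inj₂ (inj₁ (i , refl , p)))) ,
      (λ r p → ⇒does (rRel? r (step b i) b) (inj₂ (inj₂ (i , refl , p)))) ,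
      (λ u p → ⇒does (tRel? u b (step b i)) (tRel-out u b i _ st p)) ,
      (λ u p → ⇒does (tRel? u (step b i) b) (tRel-in u b i _ st p))
      where st = step-Step b i

-- Vectors as numbers, and minimal elements.

encV : ∀ {q n} → Vec (Fin q) n → Fin (q ^ n)
encV v = funToFin (V.lookup v)

decV : ∀ {q n} → Fin (q ^ n) → Vec (Fin q) n
decV {q} {n} x = tabulate (finToFun {q} {n} x)

decV-encV : ∀ {q n} (v : Vec (Fin q) n) → decV (encV v) ≡ v
decV-encV v = trans (VP.tabulate-cong (F.finToFun-funToFin (V.lookup v))) (VP.tabulate∘lookup v)

Minimal : ∀ {n} (P : Fin n → Set) (f : Fin n → ℕ) → Fin n → Set
Minimal P f a = P a × (∀ b → P b → f a ≤ f b)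

argmin : ∀ {n} {P : Fin n → Set} → (∀ a → Dec (P a)) → (f : Fin n → ℕ) → ∃ P → ∃ (Minimal P f)
argmin {n} {P} P? f (a₀ , p₀) = go (suc (f a₀)) a₀ p₀ N.≤-refl
  where
  go : ∀ k a → P a → f a < k → ∃ (Minimal P f)
  go (suc k) a p (s≤s le) with F.any? (λ b → P? b ×-dec (f b N.<? f a))
  ... | yes (b , q , lt) = go k b q (N.<-≤-trans lt le)
  ... | no none = a , p , λ b q → N.≮⇒≥ (λ lt → none (b , q , lt))

-- Index appearance records
module Record {k nA : ℕ} (hgt : Fin k → Fin nA → ℕ) (H : ℕ) (hgt<H : ∀ s a → hgt s a < H) where

  -- An absent symbol gets position `n`, so `pos s π < n` expresses that `s` occurs in `π`.
  pos : ∀ {n} → Fin k → Vec (Fin k) n → ℕ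
  pos s [] = 0
  pos s (x ∷ π) with s F.≟ x
  ... | yes _ = 0
  ... | no _  = suc (pos s π)

  -- The heights of a read in the order π as digits in base H, up to s only
  -- for val and completely for full.
  val : ∀ {n} → Fin k → Vec (Fin k) n → Fin nA → ℕ
  val s [] a = 0
  val {suc n} s (x ∷ π) a with s F.≟ x
  ... | yes _ = hgt x a * H ^ n
  ... | no _  = hgt x a * H ^ n + val s π a

  full : ∀ {n} → Vec (Fin k) n → Fin nA → ℕ
  full [] a = 0
  full {suc n} (x ∷ π) a = hgt x a * H ^ n + full π a

  full< : ∀ {n} (π : Vec (Fin k) n) a → full π a < H ^ n
  full< [] a = s≤s z≤n
  full< {suc n} (x ∷ π) a = begin-strict
    hgt x a * H ^ n + full π a <⟨ N.+-monoʳ-< (hgt x a * H ^ n) (full< π a) ⟩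
    hgt x a * H ^ n + H ^ n    ≡⟨ N.+-comm (hgt x a * H ^ n) (H ^ n) ⟩
    suc (hgt x a) * H ^ n      ≤⟨ N.*-monoˡ-≤ (H ^ n) (hgt<H x a) ⟩
    H * H ^ n                  ∎
    where open N.≤-Reasoning

  val≤full : ∀ {n} s (π : Vec (Fin k) n) a → val s π a ≤ full π a
  val≤full s [] a = z≤n
  val≤full {suc n} s (x ∷ π) a with s F.≟ x
  ... | yes _ = N.m≤m+n _ _
  ... | no _  = N.+-monoʳ-≤ (hgt x a * H ^ n) (val≤full s π a)

  val< : ∀ {n} s (π : Vec (Fin k) n) a → val s π a < H ^ n
  val< s π a = N.≤-<-trans (val≤full s π a) (full< π a)

  digit-≤ : ∀ {W p q r t} → t < W → p * W + r ≤ q * W + t → p < q ⊎ (p ≡ q × r ≤ t)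
  digit-≤ {W} {p} {q} {r} {t} t<W le with N.<-cmp p q
  ... | tri< a _ _ = inj₁ a
  ... | tri≈ _ refl _ = inj₂ (refl , N.+-cancelˡ-≤ (p * W) r t le)
  ... | tri> _ _ c = ⊥-elim (N.<⇒≱ lt le)
    where
    open N.≤-Reasoning
    lt : q * W + t < p * W + r
    lt = begin-strict
      q * W + t <⟨ N.+-monoʳ-< (q * W) t<W ⟩
      q * W + W ≡⟨ N.+-comm (q * W) W ⟩
      suc q * W ≤⟨ N.*-monoˡ-≤ W c ⟩
      p * W     ≤⟨ N.m≤m+n (p * W) r ⟩
      p * W + r ∎

  -- `val` erases the digits of `full` after that of `s`, and erasing low digits is monotone. So an
  -- element minimising `full` minimises all prefixes simultaneously.
  val-mono : ∀ {n} s (π : Vec (Fin k) n) {a b} → full π a ≤ full π b → val s π a ≤ val s π b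
  val-mono s [] le = z≤n
  val-mono {suc n} s (x ∷ π) {a} {b} le
    with s F.≟ x | digit-≤ {H ^ n} {hgt x a} {hgt x b} (full< π b) le
  ... | yes _ | inj₁ lt = N.*-monoˡ-≤ (H ^ n) (N.<⇒≤ lt)
  ... | yes _ | inj₂ (e , _) = N.≤-reflexive (cong (_* H ^ n) e)
  ... | no _  | inj₂ (e , le′) =
    N.+-mono-≤ (N.≤-reflexive (cong (_* H ^ n) e)) (val-mono s π le′)
  ... | no _  | inj₁ lt = begin
    hgt x a * H ^ n + val s π a ≤⟨ N.+-monoʳ-≤ (hgt x a * H ^ n) (N.<⇒≤ (val< s π a)) ⟩
    hgt x a * H ^ n + H ^ n     ≡⟨ N.+-comm (hgt x a * H ^ n) (H ^ n) ⟩
    suc (hgt x a) * H ^ n       ≤⟨ N.*-monoˡ-≤ (H ^ n) lt ⟩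
    hgt x b * H ^ n             ≤⟨ N.m≤m+n _ _ ⟩
    hgt x b * H ^ n + val s π b ∎
    where open N.≤-Reasoning

  -- Kept symbols retain their relative order, so none of them moves backwards; the others land at
  -- the end in reverse order.
  demote : ∀ {n} → (Fin k → Bool) → Vec (Fin k) n → Vec (Fin k) n
  demote q [] = []
  demote q (x ∷ π) with q x
  ... | true  = x ∷ demote q π
  ... | false = demote q π ∷ʳ x

  pos-snoc : ∀ {n} s (π : Vec (Fin k) n) x → pos s π < n → pos s (π ∷ʳ x) ≡ pos s π
  pos-snoc s (y ∷ π) x lt with s F.≟ y
  ... | yes _ = refl
  ... | no _  = cong suc (pos-snoc s π x (ℕ.s≤s⁻¹ lt))

  pos-snoc-self : ∀ {n} (π : Vec (Fin k) n) x → pos x (π ∷ʳ x) ≤ n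
  pos-snoc-self [] x with x F.≟ x
  ... | yes _ = z≤n
  ... | no ¬p = ⊥-elim (¬p refl)
  pos-snoc-self (y ∷ π) x with x F.≟ y
  ... | yes _ = z≤n
  ... | no _  = s≤s (pos-snoc-self π x)

  pos-lookup : ∀ {n} (π : Vec (Fin k) n) i → pos (V.lookup π i) π < n
  pos-lookup (x ∷ π) zero with x F.≟ x
  ... | yes _ = s≤s z≤n
  ... | no ¬p = ⊥-elim (¬p refl)
  pos-lookup (x ∷ π) (suc i) with V.lookup π i F.≟ x
  ... | yes _ = s≤s z≤n
  ... | no _  = s≤s (pos-lookup π i)

  pos-demote< : ∀ {n} q s (π : Vec (Fin k) n) → pos s π < n → pos s (demote q π) < n
  pos-demote< q s (x ∷ π) lt with q x
  ... | true with s F.≟ x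
  ...   | yes _ = s≤s z≤n
  ...   | no _  = s≤s (pos-demote< q s π (ℕ.s≤s⁻¹ lt))
  pos-demote< q s (x ∷ π) lt | false with s F.≟ x
  ...   | yes refl = s≤s (pos-snoc-self (demote q π) x)
  ...   | no _ = N.m<n⇒m<1+n (subst (_< _) (sym (pos-snoc s (demote q π) x ih)) ih)
    where ih = pos-demote< q s π (ℕ.s≤s⁻¹ lt)

  pos-demote : ∀ {n} q s (π : Vec (Fin k) n) → pos s π < n → q s ≡ true →
    pos s (demote q π) ≤ pos s π
  pos-demote q s (x ∷ π) lt qs with q x in qx
  ... | true with s F.≟ x
  ...   | yes _ = z≤n
  ...   | no _  = s≤s (pos-demote q s π (ℕ.s≤s⁻¹ lt) qs)
  pos-demote q s (x ∷ π) lt qs | false with s F.≟ x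
  ...   | yes refl = ⊥-elim (true≢false (trans (sym qs) qx))
  ...   | no _ = N.m≤n⇒m≤1+n (subst (_≤ _)
            (sym (pos-snoc s (demote q π) x (pos-demote< q s π (ℕ.s≤s⁻¹ lt))))
            (pos-demote q s π (ℕ.s≤s⁻¹ lt) qs))

  -- A symbol that keeps its position is preceded by kept symbols only.
  val-demote : ∀ {n} q s (π : Vec (Fin k) n) → pos s π < n → q s ≡ true →
    pos s (demote q π) ≡ pos s π → ∀ a a′ →
    (∀ x → q x ≡ true → hgt x a′ ≤ hgt x a) →
    val s (demote q π) a′ ≤ val s π a ×
    (hgt s a′ < hgt s a → val s (demote q π) a′ < val s π a)
  val-demote {suc n} q s (x ∷ π) lt qs pe a a′ mono with q x in qx
  ... | true with s F.≟ x
  ...   | yes refl = N.*-monoˡ-≤ (H ^ n) (mono x qx) , λ l → N.*-monoˡ-< (H ^ n) {{H^n≢0}} l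
    where
    H^n≢0 : NonZero (H ^ n)
    H^n≢0 = ℕ.>-nonZero (N.≤-<-trans z≤n (full< π a))
  ...   | no _ with val-demote q s π (ℕ.s≤s⁻¹ lt) qs (N.suc-injective pe) a a′ mono
  ...     | le , st = N.+-mono-≤ (N.*-monoˡ-≤ (H ^ n) (mono x qx)) le ,
                      λ l → N.+-mono-≤-< (N.*-monoˡ-≤ (H ^ n) (mono x qx)) (st l)
  val-demote {suc n} q s (x ∷ π) lt qs pe a a′ mono | false with s F.≟ x
  ...   | yes refl = ⊥-elim (true≢false (trans (sym qs) qx))
  ...   | no _ = ⊥-elim (N.<-irrefl pe (s≤s (subst (_≤ _)
            (sym (pos-snoc s (demote q π) x (pos-demote< q s π (ℕ.s≤s⁻¹ lt))))
            (pos-demote q s π (ℕ.s≤s⁻¹ lt) qs))))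

  -- The lexicographic pair of position and prefix value, packed into one number. The position leads
  -- because prefixes can be compared only while it is unchanged.
  pot : Fin k → Vec (Fin k) k → Fin nA → ℕ
  pot s π a = pos s π * H ^ k + val s π a

  Complete : Vec (Fin k) k → Set
  Complete π = ∀ s → pos s π < k

  complete-allFin : Complete (allFin k)
  complete-allFin s =
    subst (λ t → pos t (allFin k) < k) (VP.lookup-allFin s) (pos-lookup (allFin k) s)

  complete? : ∀ π → Dec (Complete π)
  complete? π = F.all? (λ s → pos s π N.<? k)

  -- A vertex may contain any vector; one that misses a symbol is read as the standard order, so
  -- that every vertex carries a complete list.
  normalise : Vec (Fin k) k → Vec (Fin k) k
  normalise π with complete? π
  ... | yes _ = π
  ... | no _  = allFin k

  normalise-complete : ∀ π → Complete (normalise π)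
  normalise-complete π with complete? π
  ... | yes c = c
  ... | no _  = complete-allFin

  normalise-id : ∀ π → Complete π → normalise π ≡ π
  normalise-id π c with complete? π
  ... | yes _ = refl
  ... | no ¬c = ⊥-elim (¬c c)

  digits-< : ∀ {W p q r t} → r < W → p < q → p * W + r < q * W + t
  digits-< {W} {p} {q} {r} {t} r<W p<q = begin-strict
    p * W + r <⟨ N.+-monoʳ-< (p * W) r<W ⟩
    p * W + W ≡⟨ N.+-comm (p * W) W ⟩
    suc p * W ≤⟨ N.*-monoˡ-≤ W p<q ⟩
    q * W     ≤⟨ N.m≤m+n (q * W) t ⟩
    q * W + t ∎
    where open N.≤-Reasoning

  potBound : ℕ
  potBound = suc k * H ^ k + 0

  pot-bound : ∀ s π → Complete π → ∀ a → pot s π a < potBound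
  pot-bound s π c a = digits-< (val< s π a) (N.m<n⇒m<1+n (c s))

  -- If `s` moves forward, the leading component falls. Otherwise all symbols before `s` are kept,
  -- their heights do not grow from `a` to `a′`, and `b` is lexicographically no larger than `a′`.
  pot-demote : ∀ q s π → Complete π → q s ≡ true → ∀ a a′ b →
    (∀ x → q x ≡ true → hgt x a′ ≤ hgt x a) → full (demote q π) b ≤ full (demote q π) a′ →
    pot s (demote q π) b ≤ pot s π a ×
    (hgt s a′ < hgt s a → pot s (demote q π) b < pot s π a)
  pot-demote q s π c qs a a′ b mono le with N.m≤n⇒m<n∨m≡n (pos-demote q s π (c s) qs)
  ... | inj₁ lt = N.<⇒≤ lt′ , λ _ → lt′
    where lt′ = digits-< (val< s (demote q π) b) lt
  ... | inj₂ e with val-demote q s π (c s) qs e a a′ mono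
  ...   | v≤ , v< =
    N.+-mono-≤ (N.≤-reflexive (cong (_* H ^ k) e)) (N.≤-trans (val-mono s (demote q π) le) v≤) ,
    λ l → N.+-mono-≤-< (N.≤-reflexive (cong (_* H ^ k) e))
            (N.≤-<-trans (val-mono s (demote q π) le) (v< l))

-- Folding the structure into a label graph.

module Labels {nA K n Q : ℕ} (T : Fin K → Fin nA → Fin nA → Bool)
  (tp : Fin nA → Fin Q) (wit : Fin nA → Fin n → Fin nA)
  (T-trans : ∀ u a b c → T u a b ≡ true → T u b c ≡ true → T u a c ≡ true)
  (a₀ : Fin nA)
  where

  k : ℕ
  k = K + K

  Tˢ : Fin k → Fin nA → Fin nA → Bool
  Tˢ = signed T

  Tˢ-trans : ∀ s a b c → Tˢ s a b ≡ true → Tˢ s b c ≡ true → Tˢ s a c ≡ true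
  Tˢ-trans s a b c p q with splitAt K s
  ... | inj₁ u = T-trans u a b c p q
  ... | inj₂ u = T-trans u c b a q p

  above : Fin k → Fin nA → Sub.Subset nA
  above s a = tabulate (λ b → Tˢ s a b ∧ not (Tˢ s b a))

  ∈above : ∀ {s a b} → Tˢ s a b ≡ true → Tˢ s b a ≡ false → b Sub.∈ above s a
  ∈above {s} {a} {b} p q =
    VP.lookup⇒[]= b _ (trans (VP.lookup∘tabulate _ b) (cong₂ (λ x y → x ∧ not y) p q))

  ∈above⁻ : ∀ {s a b} → b Sub.∈ above s a → Tˢ s a b ≡ true × Tˢ s b a ≡ false
  ∈above⁻ {s} {a} {b} m = split (Tˢ s a b) (Tˢ s b a)
      (trans (sym (VP.lookup∘tabulate (λ b → Tˢ s a b ∧ not (Tˢ s b a)) b)) (VP.[]=⇒lookup m))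
    where
    split : ∀ x y → x ∧ not y ≡ true → x ≡ true × y ≡ false
    split true false _ = refl , refl

  hgt : Fin k → Fin nA → ℕ
  hgt s a = Sub.∣ above s a ∣

  hgt<H : ∀ s a → hgt s a < suc nA
  hgt<H s a = s≤s (SubP.∣p∣≤n (above s a))

  above-mono : ∀ {s a a′} → Tˢ s a a′ ≡ true → above s a′ Sub.⊆ above s a
  above-mono {s} {a} {a′} t {b} m with ∈above⁻ {s} m
  ... | p , q = ∈above {s} (Tˢ-trans s a a′ b t p) ba
    where
    ba : Tˢ s b a ≡ false
    ba with Tˢ s b a in e
    ... | false = refl
    ... | true  = ⊥-elim (true≢false (trans (sym (Tˢ-trans s b a a′ e t)) q))

  hgt-mono : ∀ {s a a′} → Tˢ s a a′ ≡ true → hgt s a′ ≤ hgt s a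
  hgt-mono {s} t = SubP.p⊆q⇒∣p∣≤∣q∣ (above-mono {s} t)

  -- The upper set shrinks by transitivity and loses `a′`, which is not strictly above itself.
  hgt-strict : ∀ {s a a′} → Tˢ s a a′ ≡ true → Tˢ s a′ a ≡ false → hgt s a′ < hgt s a
  hgt-strict {s} {a} {a′} t f = SubP.p⊂q⇒∣p∣<∣q∣
    (above-mono {s} t , a′ , ∈above {s} t f , λ m → no-loop (∈above⁻ {s} m))
    where
    no-loop : ¬ (Tˢ s a′ a′ ≡ true × Tˢ s a′ a′ ≡ false)
    no-loop (p , q) = true≢false (trans (sym p) q)

  open Record hgt (suc nA) hgt<H

  D : Fin (2 ^ k) → Fin nA → Fin Q → Set
  D S a t = ∃ λ a′ → (∀ s → mem S s ≡ true → Tˢ s a a′ ≡ true) × tp a′ ≡ t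

  D? : ∀ S a t → Dec (D S a t)
  D? S a t = F.any? (λ a′ → F.all? (λ s → (mem S s Bo.≟ true) →-dec (Tˢ s a a′ Bo.≟ true))
                            ×-dec (tp a′ F.≟ t))

  codes : ℕ
  codes = Q * 2 ^ (2 ^ k * Q)

  profile : Fin nA → Fin (2 ^ k * Q) → Bool
  profile a j = does (D? (proj₁ (remQuot Q j)) a (proj₂ (remQuot {2 ^ k} Q j)))

  code : Fin nA → Fin codes
  code a = combine (tp a) ⟪ profile a ⟫

  code-tp : ∀ {a b} → code a ≡ code b → tp a ≡ tp b
  code-tp {a} {b} e = F.combine-injectiveˡ (tp a) ⟪ profile a ⟫ (tp b) ⟪ profile b ⟫ e

  code-D : ∀ {a b} → code a ≡ code b → ∀ S t → D S a t → D S b t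
  code-D {a} {b} e S t d = does⇒ (D? S b t) (subst (λ p → does (D? (proj₁ p) b (proj₂ p)) ≡ true)
      (F.remQuot-combine S t) (trans (sym same) (subst (λ p → does (D? (proj₁ p) a (proj₂ p)) ≡ true)
        (sym (F.remQuot-combine S t)) (⇒does (D? S a t) d))))
    where
    j = combine S t
    same : profile a j ≡ profile b j
    same = trans (sym (mem-⟪⟫ (profile a) j))
      (trans (cong (λ x → mem x j) (F.combine-injectiveʳ (tp a) ⟪ profile a ⟫ (tp b) ⟪ profile b ⟫ e))
             (mem-⟪⟫ (profile b) j))

  represent : Fin codes → Vec (Fin k) k → Fin nA
  represent x π with F.any? (λ a → code a F.≟ x)
  ... | yes p = proj₁ (argmin (λ a → code a F.≟ x) (full π) p)
  -- A number that codes no element still needs a label.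
  ... | no _  = a₀

  represent-min : ∀ a π → Minimal (λ b → code b ≡ code a) (full π) (represent (code a) π)
  represent-min a π with F.any? (λ b → code b F.≟ code a)
  ... | yes p = proj₂ (argmin (λ b → code b F.≟ code a) (full π) p)
  ... | no ¬p = ⊥-elim (¬p (a , refl))

  vertices : ℕ
  vertices = codes * k ^ k

  order : Fin vertices → Vec (Fin k) k
  order v = normalise (decV (proj₂ (remQuot {codes} (k ^ k) v)))

  elem : Fin vertices → Fin nA
  elem v = represent (proj₁ (remQuot {codes} (k ^ k) v)) (order v)

  -- The target retains only the code of the witness, and its label is a representative chosen anew
  -- under the updated order. This keeps the graph small, at the price of replacing the witness by
  -- another element.
  next : Fin vertices → Fin nA → Fin vertices
  next v a′ = combine (code a′) (encV (demote (λ s → Tˢ s (elem v) a′) (order v)))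

  order-next : ∀ v a′ → order (next v a′) ≡ demote (λ s → Tˢ s (elem v) a′) (order v)
  order-next v a′ = trans (cong (λ p → normalise (decV (proj₂ p))) (F.remQuot-combine (code a′) (encV π)))
    (trans (cong normalise (decV-encV π))
      (normalise-id π (λ s → pos-demote< _ s (order v) (normalise-complete _ s))))
    where π = demote (λ s → Tˢ s (elem v) a′) (order v)

  elem-next : ∀ v a′ → elem (next v a′) ≡ represent (code a′) (demote (λ s → Tˢ s (elem v) a′) (order v))
  elem-next v a′ = cong₂ represent (cong proj₁ (F.remQuot-combine (code a′) _)) (order-next v a′)

  next-code : ∀ v a′ → code (elem (next v a′)) ≡ code a′
  next-code v a′ = trans (cong code (elem-next v a′)) (proj₁ (represent-min a′ _))

  potᵛ : Fin k → Fin vertices → ℕ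
  potᵛ s v = pot s (order v) (elem v)

  potᵛ-bound : ∀ s v → potᵛ s v < potBound
  potᵛ-bound s v = pot-bound s (order v) (normalise-complete _) (elem v)

  -- As the edge lies in `s`, this symbol is not demoted; and the representative, being minimal
  -- among the elements with the code of the witness, is no worse than `a′`.
  potᵛ-next : ∀ s v a′ → Tˢ s (elem v) a′ ≡ true →
    potᵛ s (next v a′) ≤ potᵛ s v × (Tˢ s a′ (elem v) ≡ false → potᵛ s (next v a′) < potᵛ s v)
  potᵛ-next s v a′ t =
    N.≤-trans eq≤ (proj₁ drop) , λ f → N.≤-<-trans eq≤ (proj₂ drop (hgt-strict {s} t f))
    where
    q : Fin k → Bool
    q s = Tˢ s (elem v) a′
    b = represent (code a′) (demote q (order v))
    eq≤ : potᵛ s (next v a′) ≤ pot s (demote q (order v)) b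
    eq≤ = N.≤-reflexive (cong₂ (pot s) (order-next v a′) (elem-next v a′))
    drop = pot-demote q s (order v) (normalise-complete _) t (elem v) a′ b
             (λ x → hgt-mono {x}) (proj₂ (represent-min a′ (demote q (order v))) a′ refl)

  up down : Fin K → Fin k
  up u   = u ↑ˡ K
  down u = K ↑ʳ u

  higher : Fin k → Fin vertices → Fin vertices → Fin vertices
  higher s v w with potᵛ s v N.≤? potᵛ s w
  ... | yes _ = w
  ... | no _  = v

  potᵛ-higher : ∀ s v w → potᵛ s (higher s v w) ≡ potᵛ s v ⊔ potᵛ s w
  potᵛ-higher s v w with potᵛ s v N.≤? potᵛ s w
  ... | yes le = sym (N.m≤n⇒m⊔n≡n le)
  ... | no ¬le = sym (N.m≥n⇒m⊔n≡m (N.<⇒≤ (N.≰⇒> ¬le)))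

  -- How the current T u-clique was entered: against T u, without T u, or
  -- along T u, and a vertex of maximal potential visited since.
  Entry : Set
  Entry = Fin 3 × Fin vertices

  -- The three kinds of entry occupy three bands: below, at and above `potBound`. A one-way edge
  -- that changes the band thus moves the rank in the right direction. Inside the lowest band
  -- further descents lower the `down` potential; inside the highest, further ascents lower the `up`
  -- potential, which is subtracted.
  height : Fin K → Entry → Fin vertices → ℕ
  height u (zero , w)             v = potᵛ (down u) w ⊔ potᵛ (down u) v
  height u (suc zero , w)         v = potBound
  height u (suc (suc zero) , w)   v = (potBound + potBound) ∸ (potᵛ (up u) w ⊔ potᵛ (up u) v)

  entry : Fin K → Bool → Bool → Entry → Fin vertices → Fin vertices → Entry
  entry u true  true  (zero , w)           v v′ = zero , higher (down u) w v
  entry u true  true  (suc zero , w)       v v′ = suc zero , w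
  entry u true  true  (suc (suc zero) , w) v v′ = suc (suc zero) , higher (up u) w v
  entry u true  false _                    v v′ = suc (suc zero) , v′
  entry u false true  _                    v v′ = zero , v′
  entry u false false _                    v v′ = suc zero , v′

  ⊔<potBound : ∀ s v w → potᵛ s v ⊔ potᵛ s w < potBound
  ⊔<potBound s v w = N.⊔-lub (potᵛ-bound s v) (potᵛ-bound s w)

  bound<∸ : ∀ {x} → x < potBound → potBound < (potBound + potBound) ∸ x
  bound<∸ {x} lt = subst (_< (potBound + potBound) ∸ x) (N.m+n∸n≡m potBound potBound)
    (N.∸-monoʳ-< lt (N.m≤n+m potBound potBound))

  module _ (u : Fin K) (v : Fin vertices) (a′ : Fin nA) where
    private
      v′ = next v a′

    Tup : T u (elem v) a′ ≡ true → Tˢ (up u) (elem v) a′ ≡ true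
    Tup p = trans (signed-ˡ T u (elem v) a′) p

    Tdown : T u a′ (elem v) ≡ true → Tˢ (down u) (elem v) a′ ≡ true
    Tdown p = trans (signed-ʳ T u (elem v) a′) p

    -- The potential may drop along a two-way edge. The remembered maximum already dominates that of
    -- the new vertex, so the height does not change.
    height-eq : ∀ t → T u (elem v) a′ ≡ true → T u a′ (elem v) ≡ true →
      height u t v ≡ height u (entry u true true t v v′) v′
    height-eq (zero , w) p q = sym (trans
      (cong (_⊔ potᵛ (down u) v′) (potᵛ-higher (down u) w v))
      (N.m≥n⇒m⊔n≡m (N.≤-trans (proj₁ (potᵛ-next (down u) v a′ (Tdown q)))
                              (N.m≤n⊔m (potᵛ (down u) w) (potᵛ (down u) v)))))
    height-eq (suc zero , w) p q = refl
    height-eq (suc (suc zero) , w) p q = cong ((potBound + potBound) ∸_) (sym (trans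
      (cong (_⊔ potᵛ (up u) v′) (potᵛ-higher (up u) w v))
      (N.m≥n⇒m⊔n≡m (N.≤-trans (proj₁ (potᵛ-next (up u) v a′ (Tup p)))
                              (N.m≤n⊔m (potᵛ (up u) w) (potᵛ (up u) v))))))

    height-fwd : ∀ t → T u (elem v) a′ ≡ true → T u a′ (elem v) ≡ false →
      height u t v < height u (entry u true false t v v′) v′
    height-fwd (zero , w) p q = N.<-trans (⊔<potBound (down u) w v) (bound<∸ (⊔<potBound (up u) v′ v′))
    height-fwd (suc zero , w) p q = bound<∸ (⊔<potBound (up u) v′ v′)
    height-fwd (suc (suc zero) , w) p q = N.∸-monoʳ-<
      (N.<-≤-trans (subst (_< potᵛ (up u) v) (sym (N.⊔-idem _))
                     (proj₂ (potᵛ-next (up u) v a′ (Tup p)) (trans (signed-ˡ T u a′ (elem v)) q)))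
                   (N.m≤n⊔m (potᵛ (up u) w) (potᵛ (up u) v)))
      (N.≤-trans (N.<⇒≤ (⊔<potBound (up u) w v)) (N.m≤m+n potBound potBound))

    height-bwd : ∀ t → T u (elem v) a′ ≡ false → T u a′ (elem v) ≡ true →
      height u (entry u false true t v v′) v′ < height u t v
    height-bwd (zero , w) p q =
      N.<-≤-trans (subst (_< potᵛ (down u) v) (sym (N.⊔-idem _))
                     (proj₂ (potᵛ-next (down u) v a′ (Tdown q)) (trans (signed-ʳ T u a′ (elem v)) p)))
                   (N.m≤n⊔m (potᵛ (down u) w) (potᵛ (down u) v))
    height-bwd (suc zero , w) p q = ⊔<potBound (down u) v′ v′
    height-bwd (suc (suc zero) , w) p q =
      N.<-trans (⊔<potBound (down u) v′ v′) (bound<∸ (⊔<potBound (up u) w v))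

  labels : ℕ
  labels = vertices * (3 * vertices) ^ K

  vtx : Fin labels → Fin vertices
  vtx l = proj₁ (remQuot {vertices} ((3 * vertices) ^ K) l)

  entryOf : Fin labels → Fin K → Entry
  entryOf l u = remQuot {3} vertices (finToFun (proj₂ (remQuot {vertices} ((3 * vertices) ^ K) l)) u)

  mkL : Fin vertices → (Fin K → Entry) → Fin labels
  mkL v f = combine v (funToFin (λ u → combine (proj₁ (f u)) (proj₂ (f u))))

  vtx-mkL : ∀ v f → vtx (mkL v f) ≡ v
  vtx-mkL v f = cong proj₁ (F.remQuot-combine v (funToFin λ u → combine (proj₁ (f u)) (proj₂ (f u))))

  entryOf-mkL : ∀ v f u → entryOf (mkL v f) u ≡ f u
  entryOf-mkL v f u = trans
    (cong (λ p → remQuot {3} vertices (finToFun (proj₂ p) u))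
      (F.remQuot-combine v (funToFin g)))
    (trans (cong (remQuot {3} vertices) (F.finToFun-funToFin g u))
           (F.remQuot-combine (proj₁ (f u)) (proj₂ (f u))))
    where
    g : Fin K → Fin (3 * vertices)
    g u = combine (proj₁ (f u)) (proj₂ (f u))

  lab : Fin labels → Fin nA
  lab l = elem (vtx l)

  entries : Fin labels → Fin nA → Fin K → Entry
  entries l a′ u = entry u (T u (lab l) a′) (T u a′ (lab l)) (entryOf l u) (vtx l) (next (vtx l) a′)

  tgt : Fin labels → Fin n → Fin labels
  tgt l i = mkL (next (vtx l) (wit (lab l) i)) (entries l (wit (lab l) i))

  vtx-tgt : ∀ l i → vtx (tgt l i) ≡ next (vtx l) (wit (lab l) i)
  vtx-tgt l i = vtx-mkL (next (vtx l) (wit (lab l) i)) (entries l (wit (lab l) i))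

  code-tgt : ∀ l i → code (lab (tgt l i)) ≡ code (wit (lab l) i)
  code-tgt l i = trans (cong (code ∘ elem) (vtx-tgt l i)) (next-code (vtx l) _)

  rank : Fin K → Fin labels → ℕ
  rank u l = height u (entryOf l u) (vtx l)

  rank-tgt : ∀ u l i {p q} → T u (lab l) (wit (lab l) i) ≡ p → T u (wit (lab l) i) (lab l) ≡ q →
    rank u (tgt l i) ≡
    height u (entry u p q (entryOf l u) (vtx l) (next (vtx l) (wit (lab l) i))) (next (vtx l) (wit (lab l) i))
  rank-tgt u l i refl refl = cong₂ (height u)
    (entryOf-mkL (next (vtx l) (wit (lab l) i)) (entries l (wit (lab l) i)) u) (vtx-tgt l i)

  -- Labels are only representatives, so a path in the graph is not a chain in A. The inclusion
  -- between the types found `S`-above the two labels depends on codes alone and makes the relation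
  -- transitive.
  P : Fin (2 ^ k) → Fin labels → Fin labels → Set
  P S l l′ = D S (lab l) (tp (lab l′)) × (∀ t → D S (lab l′) t → D S (lab l) t)

  D-mono : ∀ S {a a′} → (∀ s → mem S s ≡ true → Tˢ s a a′ ≡ true) → ∀ t → D S a′ t → D S a t
  D-mono S {a} {a′} H t (b , f , e) = b , (λ s ms → Tˢ-trans s a a′ b (H s ms) (f s ms)) , e

  graph : LabelGraph T tp wit labels
  graph = record
    { start = let v = combine (code a₀) (encV (allFin k)) in mkL v (λ _ → zero , v)
    ; lab = lab ; tgt = tgt
    ; tgt-tp = λ l i → sym (code-tp (code-tgt l i))
    ; rank = rank
    ; rank-fwd = λ u l i p q → subst (rank u l <_) (sym (rank-tgt u l i p q))
        (height-fwd u (vtx l) _ (entryOf l u) p q)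
    ; rank-bwd = λ u l i p q → subst (_< rank u l) (sym (rank-tgt u l i p q))
        (height-bwd u (vtx l) _ (entryOf l u) p q)
    ; rank-eq = λ u l i p q → trans (height-eq u (vtx l) _ (entryOf l u) p q) (sym (rank-tgt u l i p q))
    ; P = P
    ; P? = λ S l l′ → D? S (lab l) (tp (lab l′)) ×-dec
        F.all? (λ t → D? S (lab l′) t →-dec D? S (lab l) t)
    ; P-trans = λ { S (d₁ , i₁) (d₂ , i₂) → i₁ _ d₂ , λ t d → i₁ t (i₂ t d) }
    ; P-out = λ S l i H →
        (wit (lab l) i , H , sym (code-tp (code-tgt l i))) ,
        λ t d → D-mono S H t (code-D (code-tgt l i) S t d)
    ; P-in = λ S l i H →
        code-D (sym (code-tgt l i)) S _ (lab l , H , refl) ,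
        λ t d → code-D (sym (code-tgt l i)) S t (D-mono S H t d)
    ; P-real = λ { S l l′ ((a , H , e) , _) → a , e , H }
    }

-- Size estimates.

1≤2^ : ∀ x → 1 ≤ 2 ^ x
1≤2^ x = N.m^n>0 2 x

x≤2^x : ∀ x → x ≤ 2 ^ x
x≤2^x zero    = z≤n
x≤2^x (suc x) = N.+-mono-≤ (1≤2^ x) (N.≤-trans (x≤2^x x) (N.≤-reflexive (sym (N.+-identityʳ _))))

2^-mono : ∀ {x y} → x ≤ y → 2 ^ x ≤ 2 ^ y
2^-mono = N.^-monoʳ-≤ 2

module Sizes (n : ℕ) where

  codes vertices labels size : ℕ
  codes    = 2 ^ n * 2 ^ (2 ^ (n + n) * 2 ^ n)
  vertices = codes * (n + n) ^ (n + n)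
  labels   = vertices * (3 * vertices) ^ n
  size     = labels * (3 + labels * n) ^ (labels * n)

module Bounds (n : ℕ) (1≤n : 1 ≤ n) where

  open Sizes n

  -- All sizes are compared with `Exp i` or `2 ^ Exp i`, so that sums, products and powers merely
  -- increase the coefficient `i`.
  Exp : ℕ → ℕ
  Exp i = 2 ^ (i * n)

  exp-+ : ∀ {i x y} → x ≤ Exp i → y ≤ Exp i → x + y ≤ Exp (suc i)
  exp-+ {i} {x} {y} p q = begin
    x + y           ≤⟨ N.+-mono-≤ p q ⟩
    Exp i + Exp i   ≡⟨ cong (λ x → Exp i + x) (sym (N.+-identityʳ (Exp i))) ⟩
    -- The factor two is absorbed by one more multiple of the positive `n`.
    2 ^ (1 + i * n) ≤⟨ 2^-mono (N.+-monoˡ-≤ (i * n) 1≤n) ⟩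
    Exp (suc i)     ∎
    where open N.≤-Reasoning

  exp-* : ∀ {i j x y} → x ≤ Exp i → y ≤ Exp j → x * y ≤ Exp (i + j)
  exp-* {i} {j} {x} {y} p q = begin
    x * y               ≤⟨ N.*-mono-≤ p q ⟩
    Exp i * Exp j       ≡⟨ sym (N.^-distribˡ-+-* 2 (i * n) (j * n)) ⟩
    2 ^ (i * n + j * n) ≡⟨ cong (2 ^_) (sym (N.*-distribʳ-+ n i j)) ⟩
    Exp (i + j)         ∎
    where open N.≤-Reasoning

  exp-weaken : ∀ {i j x} → i ≤ j → x ≤ Exp i → x ≤ Exp j
  exp-weaken i≤j p = N.≤-trans p (2^-mono (N.*-monoˡ-≤ n i≤j))

  2^n≤Exp : 2 ^ n ≤ Exp 1
  2^n≤Exp = 2^-mono (N.≤-reflexive (sym (N.+-identityʳ n)))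

  n≤Exp : n ≤ Exp 1
  n≤Exp = N.≤-trans (x≤2^x n) 2^n≤Exp

  2-exp-weaken : ∀ {i j x} → i ≤ j → x ≤ 2 ^ Exp i → x ≤ 2 ^ Exp j
  2-exp-weaken i≤j p = N.≤-trans p (2^-mono (exp-weaken i≤j N.≤-refl))

  2-exp-* : ∀ {i x y} → x ≤ 2 ^ Exp i → y ≤ 2 ^ Exp i → x * y ≤ 2 ^ Exp (suc i)
  2-exp-* {i} {x} {y} p q = begin
    x * y                 ≤⟨ N.*-mono-≤ p q ⟩
    2 ^ Exp i * 2 ^ Exp i ≡⟨ sym (N.^-distribˡ-+-* 2 (Exp i) (Exp i)) ⟩
    2 ^ (Exp i + Exp i)   ≤⟨ 2^-mono (exp-+ {i} N.≤-refl N.≤-refl) ⟩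
    2 ^ Exp (suc i)       ∎
    where open N.≤-Reasoning

  2-exp-+ : ∀ {i x y} → x ≤ 2 ^ Exp i → y ≤ 2 ^ Exp i → x + y ≤ 2 ^ Exp (suc i)
  2-exp-+ {i} {x} {y} p q = begin
    x + y                 ≤⟨ N.+-mono-≤ p q ⟩
    2 ^ Exp i + 2 ^ Exp i ≡⟨ cong (λ x → 2 ^ Exp i + x) (sym (N.+-identityʳ (2 ^ Exp i))) ⟩
    2 ^ (1 + Exp i)       ≤⟨ 2^-mono (exp-+ {i} (1≤2^ (i * n)) N.≤-refl) ⟩
    2 ^ Exp (suc i)       ∎
    where open N.≤-Reasoning

  ^-bound : ∀ {x y a b} → x ≤ 2 ^ a → y ≤ b → x ^ y ≤ 2 ^ (a * b)
  ^-bound {x} {y} {a} {b} p q = begin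
    x ^ y       ≤⟨ N.^-monoˡ-≤ y p ⟩
    (2 ^ a) ^ y ≡⟨ N.^-*-assoc 2 a y ⟩
    2 ^ (a * y) ≤⟨ 2^-mono (N.*-monoʳ-≤ a q) ⟩
    2 ^ (a * b) ∎
    where open N.≤-Reasoning

  2-exp-^ : ∀ {i j x y} → x ≤ 2 ^ Exp i → y ≤ Exp j → x ^ y ≤ 2 ^ Exp (i + j)
  2-exp-^ {i} {j} p q = N.≤-trans (^-bound {a = Exp i} p q) (2^-mono (exp-* {i} {j} N.≤-refl N.≤-refl))

  2-exp-small : ∀ {i x} → x ≤ Exp i → x ≤ 2 ^ Exp i
  2-exp-small {i} {x} p = N.≤-trans (x≤2^x x) (2^-mono p)

  3≤2-exp : 3 ≤ 2 ^ Exp 1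
  3≤2-exp = N.≤-trans (N.n≤1+n 3) (2^-mono {2} {Exp 1} (exp-+ {0} N.≤-refl N.≤-refl))

  codes-bound : codes ≤ 2 ^ Exp 4
  codes-bound = 2-exp-* {3} (2-exp-weaken {1} {3} (s≤s z≤n) (2^-mono (n≤Exp)))
    (2^-mono (exp-* {2} {1}
      (N.≤-trans (N.≤-reflexive (N.^-distribˡ-+-* 2 n n)) (exp-* {1} {1} 2^n≤Exp 2^n≤Exp)) 2^n≤Exp))

  vertices-bound : vertices ≤ 2 ^ Exp 5
  vertices-bound = 2-exp-* {4} codes-bound (2-exp-^ {2} {2} (2-exp-small {2} n+n) n+n)
    where
    n+n : n + n ≤ Exp 2
    n+n = exp-+ {1} n≤Exp n≤Exp

  labels-bound : labels ≤ 2 ^ Exp 8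
  labels-bound = 2-exp-* {7} (2-exp-weaken {5} (N.m≤m+n 5 2) vertices-bound)
    (2-exp-^ {6} {1} (2-exp-* {5} (2-exp-weaken {1} {5} (s≤s z≤n) 3≤2-exp) vertices-bound) n≤Exp)

  edges-bound : labels * n ≤ 2 ^ Exp 9
  edges-bound = 2-exp-* {8} labels-bound (2-exp-weaken {1} {8} (s≤s z≤n) (2-exp-small {1} n≤Exp))

  -- The number of labels is doubly exponential. The third exponential comes from having one
  -- coordinate per edge, which puts `labels * n` into the exponent.
  size-bound : size ≤ 2 ^ (2 ^ (2 ^ (12 * n)))
  size-bound = begin
    labels * (3 + labels * n) ^ (labels * n)
      ≤⟨ N.*-mono-≤ (N.≤-trans labels-bound (2^-mono (2-exp-weaken {8} (N.m≤m+n 8 3) (x≤2^x (Exp 8)))))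
           (N.≤-trans (^-bound {a = Exp 10} modulus-bound edges-bound)
             (2^-mono (2-exp-* {10} (x≤2^x (Exp 10)) (2-exp-weaken {9} (N.m≤m+n 9 1) N.≤-refl)))) ⟩
    2 ^ (2 ^ Exp 11) * 2 ^ (2 ^ Exp 11)
      ≡⟨ sym (N.^-distribˡ-+-* 2 (2 ^ Exp 11) (2 ^ Exp 11)) ⟩
    2 ^ (2 ^ Exp 11 + 2 ^ Exp 11)
      ≤⟨ 2^-mono (2-exp-+ {11} N.≤-refl N.≤-refl) ⟩
    2 ^ (2 ^ Exp 12) ∎
    where
    open N.≤-Reasoning
    modulus-bound : 3 + labels * n ≤ 2 ^ Exp 10
    modulus-bound = 2-exp-+ {9} (2-exp-weaken {1} {9} (s≤s z≤n) 3≤2-exp) edges-bound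

-- Assembly of the small model.

module _ {k nA : ℕ} (A : Str k nA) (adm : Admissible A) (φ : Fm k) where

  private
    n = length (subs φ)

  -- Both variables are evaluated at `a`, also in subformulas with two free variables, so that the
  -- type records the loops at `a`.
  type : Fin nA → Fin (2 ^ n)
  type a = ⟪ (λ j → does (sat? A (lookup (subs φ) j) (const a))) ⟫

  type-sat : ∀ {a a′} j → type a ≡ type a′ →
    A ⊨ lookup (subs φ) j [ const a ] → A ⊨ lookup (subs φ) j [ const a′ ]
  type-sat {a} {a′} j e p = does⇒ (sat? A (lookup (subs φ) j) (const a′))
    (trans (sym (mem-⟪⟫ (λ j → does (sat? A (lookup (subs φ) j) (const a′))) j))
    (trans (cong (λ x → mem x j) (sym e))
    (trans (mem-⟪⟫ (λ j → does (sat? A (lookup (subs φ) j) (const a))) j)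
           (⇒does (sat? A (lookup (subs φ) j) (const a)) p))))

  type-sat-∈ : ∀ {a a′ ψ} → type a ≡ type a′ → ψ ∈ subs φ →
    A ⊨ ψ [ const a ] → A ⊨ ψ [ const a′ ]
  type-sat-∈ {a} {a′} e m p = subst (λ ψ → A ⊨ ψ [ const a′ ]) (sym (lookup-index m))
    (type-sat (index m) e (subst (λ ψ → A ⊨ ψ [ const a ]) (lookup-index m) p))

  loop-sat : ∀ ψ {a a′} → (A ⊨ ψ [ const a ] → A ⊨ ψ [ const a′ ]) →
    TransRel A ψ a a ≡ true → TransRel A ψ a′ a′ ≡ true
  loop-sat (TA (u , fwd) _ _) H p = H p
  loop-sat (TA (u , bwd) _ _) {a} {a′} H p =
    trans (sym (proj₂ adm u a′ a′)) (H (trans (proj₂ adm u a a) p))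

  rel : Fin n → Fin nA → Fin nA → Bool
  rel j = TransRel A (lookup (subs φ) j)

  wit : Fin nA → Fin n → Fin nA
  wit a j = witness A (lookup (subs φ) j) a

  cover-model : ∀ {size} → Cover rel (R2 A) type wit size → IsUNFO φ → (∀ a → A ⊨ φ [ const a ]) →
    HasAdmModelOfSize φ size
  cover-model cov i H = B , B-admissible , const (Cover.point cov) , sentence-transfer i H
    where open Transfer A adm φ type type-sat-∈ cov using (B; B-admissible; sentence-transfer)

  abstract
    small-cover : Fin nA → Cover rel (R2 A) type wit (Sizes.size n)
    small-cover a₀ = Construction.cover rel (R2 A) type wit rel-trans
        (λ u e → loop-sat (lookup (subs φ) u) (type-sat u e)) (Labels.graph rel type wit rel-trans a₀)
      where
      rel-trans : ∀ u a b c → rel u a b ≡ true → rel u b c ≡ true → rel u a c ≡ true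
      rel-trans u = TransRel-trans A adm (lookup (subs φ) u)

  abstract
    small-model : IsUNFO φ → Fin nA → (∀ a → A ⊨ φ [ const a ]) → 1 ≤ n → ∀ b → 12 * n ≤ b →
      ∃[ m ] (m ≤ 2 ^ (2 ^ (2 ^ b))) × HasAdmModelOfSize φ m
    small-model i a₀ H 1≤n b le = Sizes.size n ,
      N.≤-trans (Bounds.size-bound n 1≤n) (2^-mono (2^-mono (2^-mono le))) , cover-model (small-cover a₀) i H

open-model : ∀ {k} (φ : Fm k) {m} → HasAdmModelOfSize (ex vx (ex vy φ)) m → HasAdmModelOfSize φ m
open-model φ (B , adm , σ , b , c , q) = B , adm , update (update σ vx b) vy c , q

theorem6 : Σ Poly λ p → ∀ (k : ℕ) (φ : Fm k) → IsUNFO φ → FinSat φ →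
    ∃[ m ] (m ≤ 2 ^ (2 ^ (2 ^ evalP p (len φ)))) × HasAdmModelOfSize φ m
-- The transfer starts from constant assignments, so `φ` is closed by two quantifiers first and the
-- values of its variables are recovered at the end. The closure has length `4 + len φ`, which makes
-- the exponent `12 * (4 + len φ)`.
theorem6 = 48 ∷ 12 ∷ [] , λ k φ i (nA , A , adm , ρ , p) →
  let m , m≤ , B = small-model A adm (ex vx (ex vy φ)) i (ρ vx)
        (λ a → ρ vx , ρ vy , sat-agree A φ (λ v _ → rebuild ρ (const a) v) p) (s≤s z≤n)
        (evalP (48 ∷ 12 ∷ []) (len φ)) (length-bound φ)
  in m , m≤ , open-model φ B
  where
  rebuild : ∀ {n} (ρ σ : Asg n) v → ρ v ≡ update (update σ vx (ρ vx)) vy (ρ vy) v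
  rebuild ρ σ vx = refl
  rebuild ρ σ vy = refl

  poly : ∀ x → 12 * (4 + x) ≡ 48 + x * (12 + x * 0)
  poly = solve-ℕ

  length-bound : ∀ {k} (φ : Fm k) →
    12 * length (subs (ex vx (ex vy φ))) ≤ evalP (48 ∷ 12 ∷ []) (len φ)
  length-bound φ =
    N.≤-trans (N.*-monoʳ-≤ 12 (length-subs (ex vx (ex vy φ)))) (N.≤-reflexive (poly (len φ)))
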